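{- Let $\mathcal{F}$ be the group, under convolution $*$, of all functions $f : NC^{(2)} \to \mathbb{C}$ such that $f(\pi,\pi)=1$ for every $\pi \in \sqcup_{n=1}^{\infty} NC(n)$, and let $\widetilde{\mathcal{G}} \subseteq \mathcal{F}$ be the set of unitized semi-multiplicative functions. Then $\widetilde{\mathcal{G}}$ is a subgroup of $(\mathcal{F}, *)$.
   Context: For $n \ge 1$, $NC(n)$ is the set of non-crossing partitions of $\{1,\ldots,n\}$, partially ordered by reverse refinement: $\pi \le \sigma$ iff every block of $\sigma$ is a union of blocks of $\pi$. $1_n \in NC(n)$ is the partition with a single block. Put $NC^{(2)} := \sqcup_{n=1}^{\infty} \{ (\pi,\sigma) \mid \pi,\sigma \in NC(n),\ \pi \le \sigma \}$. Relabeled restriction: for $\pi \in NC(n)$ and a non-empty $W = \{p_1 < \cdots < p_m\} \subseteq \{1,\ldots,n\}$, $\pi_W \in NC(m)$ is the partition for which $i,j$ are in the same block of $\pi_W$ iff $p_i,p_j$ are in the same block of $\pi$. Convolution: for $f,g : NC^{(2)} \to \mathbb{C}$, $(f*g)(\pi,\sigma) = \sum_{\rho \in NC(n),\ \pi \le \rho \le \sigma} f(\pi,\rho) g(\rho,\sigma)$ for $\pi \le \sigma$ in $NC(n)$. The unit is $e$, with $e(\pi,\sigma)=1$ if $\pi=\sigma$ and $0$ otherwise. $(\mathcal{F},*)$ is a group. Unitized semi-multiplicative functions: $\widetilde{\mathcal{G}}$ is the set of functions $g : NC^{(2)} \to \mathbb{C}$ such that $g(\pi,\pi)=1$ for all $\pi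 \in \sqcup_{n} NC(n)$ and such that $g(\pi,\sigma) = \prod_{W \in \sigma} g(\pi_W, 1_{|W|})$ for every $n \ge 1$ and $\pi \le \sigma$ in $NC(n)$ (product over the blocks $W$ of $\sigma$). -}

module Defs where

open import Algebra.Bundles using (CommutativeRing; Group; Monoid)
import Algebra.Properties.CommutativeSemigroup as CommutativeSemigroupProperties
import Algebra.Properties.Ring as RingProperties
open import Data.Bool.Base using (true; false; if_then_else_)
import Data.Bool.Properties as Bool
open import Data.Fin.Base using (Fin; zero; suc; _<_)
open import Data.Fin.Properties using (all?; _<?_)
open import Data.Fin.Subset using (Subset; inside; outside; _∈_; _⊆_; ⊤; ⋃; ∣_∣)
open import Data.Fin.Subset.Properties
  using (_∈?_; _⊆?_; ⊆-antisym; drop-∷-⊆; x∈p∪q⁻; p⊆p∪q; q⊆p∪q; ∉⊥; ∈⊤; p⊆q⇒∣p∣≤∣q∣)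
open import Data.List.Base
  using (List; []; _∷_; foldr; map; mapMaybe; filter; deduplicate; cartesianProductWith)
open import Data.List.Membership.Propositional using (mapWith∈) renaming (_∈_ to _∈ˡ_)
open import Data.List.Membership.Propositional.Properties
  using (∈-deduplicate⁺; ∈-deduplicate⁻; ∈-filter⁺; ∈-filter⁻; ∈-cartesianProductWith⁺)
open import Data.List.Relation.Binary.Subset.Propositional using () renaming (_⊆_ to _⊆ˡ_)
open import Data.List.Relation.Unary.All as All using (All; []; _∷_)
open import Data.List.Relation.Unary.AllPairs using ([]; _∷_)
open import Data.List.Relation.Unary.Any using (here; there)
open import Data.List.Relation.Unary.Unique.Propositional using (Unique)
open import Data.List.Relation.Unary.Unique.Propositional.Properties using (cartesianProductWith⁺)
open import Data.Maybe.Base using (Maybe; just; nothing; maybe′)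
open import Data.Nat.Base as ℕ using (ℕ; zero; suc; NonZero; z≤n; s≤s)
import Data.Nat.Properties as ℕ
open import Data.Product.Base using (∃-syntax; _×_; _,_; proj₁; proj₂)
open import Data.Sum.Base using (inj₁; inj₂)
open import Data.Vec.Base as Vec using (Vec; []; _∷_; lookup; tabulate; toList; replicate)
open import Data.Vec.Properties
  using (≡-dec; lookup-replicate; lookup∘tabulate; tabulate-cong; []=⇒lookup; lookup⇒[]=;
         ∷-injective)
open import Data.Vec.Membership.Propositional.Properties using (∈-lookup; ∈-toList⁺; ∈-toList⁻)
open import Data.Vec.Relation.Unary.Any using (index)
open import Data.Vec.Relation.Unary.Any.Properties using (lookup-index)
open import Function.Base using (_∘_)
open import Level using (Level; _⊔_)
open import Relation.Binary.Definitions using (DecidableEquality; _Respects_)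
open import Relation.Binary.PropositionalEquality
  using (_≡_; _≢_; refl; sym; trans; cong; cong₂; subst)
import Relation.Binary.Reasoning.Setoid as SetoidReasoning
open import Relation.Nullary using (¬_; Dec; yes; no; does; contradiction)
open import Relation.Nullary.Decidable using (map′; _×-dec_; _→-dec_; recompute; dec-true; dec-false)
open import Relation.Unary using (Pred)

private variable
  n : ℕ
  a b p c ℓ : Level
  A : Set a
  B : Set b

infix 4 _≟ˢ_ _≟ᴺ_ _≼_ _≼?_

_≟ˢ_ : DecidableEquality (Subset n)
_≟ˢ_ = ≡-dec Bool._≟_

-- A partition of Fin n is encoded by the vector whose i-th entry is the
-- block containing i.  The laws `self` and `same` say that the entries
-- cover Fin n and are pairwise equal or disjoint.

record IsNonCrossingPartition (B : Vec (Subset n) n) : Set where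
  field
    self        : ∀ i → i ∈ lookup B i
    same        : ∀ i j → j ∈ lookup B i → lookup B j ≡ lookup B i
    nonCrossing : ∀ i j k l → i < j → j < k → k < l →
                  k ∈ lookup B i → l ∈ lookup B j → lookup B i ≡ lookup B j

open IsNonCrossingPartition

isNonCrossingPartition? : (B : Vec (Subset n) n) → Dec (IsNonCrossingPartition B)
isNonCrossingPartition? B =
  map′ (λ (s , t , u) → record { self = s ; same = t ; nonCrossing = u })
       (λ P → self P , same P , nonCrossing P)
       (all? (λ i → i ∈? lookup B i)
        ×-dec all? (λ i → all? λ j →
          (j ∈? lookup B i) →-dec (lookup B j ≟ˢ lookup B i))
        ×-dec all? (λ i → all? λ j → all? λ k → all? λ l →
          (i <? j) →-dec (j <? k) →-dec (k <? l) →-dec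
          (k ∈? lookup B i) →-dec (l ∈? lookup B j) →-dec
          (lookup B i ≟ˢ lookup B j)))

-- The proof is irrelevant, so that _≡_ on NC n is equality of partitions.

record NC (n : ℕ) : Set where
  constructor nc
  field
    blockVec : Vec (Subset n) n
    .isNCP   : IsNonCrossingPartition blockVec

open NC using (blockVec)

isNCP : (π : NC n) → IsNonCrossingPartition (blockVec π)
isNCP (nc B P) = recompute (isNonCrossingPartition? B) P

blockOf : NC n → Fin n → Subset n
blockOf π = lookup (blockVec π)

blocks : NC n → List (Subset n)
blocks π = deduplicate _≟ˢ_ (toList (blockVec π))

nc-injective : {π σ : NC n} → blockVec π ≡ blockVec σ → π ≡ σ
nc-injective {π = nc _ _} {nc _ _} refl = refl

_≟ᴺ_ : DecidableEquality (NC n)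
π ≟ᴺ σ = map′ nc-injective (cong blockVec) (≡-dec _≟ˢ_ (blockVec π) (blockVec σ))

blockOf∈blocks : (π : NC n) (i : Fin n) → blockOf π i ∈ˡ blocks π
blockOf∈blocks π i = ∈-deduplicate⁺ _≟ˢ_ (∈-toList⁺ (∈-lookup i (blockVec π)))

∈blocks⇒blockOf : (π : NC n) {W : Subset n} → W ∈ˡ blocks π → ∃[ i ] W ≡ blockOf π i
∈blocks⇒blockOf π {W} W∈ = index W∈v , lookup-index W∈v
  where W∈v = ∈-toList⁻ (∈-deduplicate⁻ _≟ˢ_ (toList (blockVec π)) W∈)

∈⇒nonZero : {i : Fin n} {W : Subset n} → i ∈ W → NonZero ∣ W ∣
∈⇒nonZero {i = zero}  {inside  ∷ W} _ = _
∈⇒nonZero {i = suc i} {inside  ∷ W} _ = _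
∈⇒nonZero {i = suc i} {outside ∷ W} (Vec.there i∈W) = ∈⇒nonZero i∈W

block-nonZero : (π : NC n) {W : Subset n} → W ∈ˡ blocks π → NonZero ∣ W ∣
block-nonZero π W∈ with i , refl ← ∈blocks⇒blockOf π W∈ = ∈⇒nonZero (self (isNCP π) i)

record _≼_ (π σ : NC n) : Set where
  constructor refines
  field
    union : ∀ W → W ∈ˡ blocks σ → ∃[ Vs ] (Vs ⊆ˡ blocks π × W ≡ ⋃ Vs)

∈⋃⁻ : (Vs : List (Subset n)) {i : Fin n} → i ∈ ⋃ Vs → ∃[ V ] (V ∈ˡ Vs × i ∈ V)
∈⋃⁻ []       i∈ = contradiction i∈ ∉⊥
∈⋃⁻ (V ∷ Vs) i∈ with x∈p∪q⁻ V (⋃ Vs) i∈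
... | inj₁ i∈V = V , here refl , i∈V
... | inj₂ i∈⋃ = let V′ , V′∈ , i∈V′ = ∈⋃⁻ Vs i∈⋃ in V′ , there V′∈ , i∈V′

∈⋃⁺ : {Vs : List (Subset n)} {V : Subset n} → V ∈ˡ Vs → V ⊆ ⋃ Vs
∈⋃⁺ {Vs = V ∷ Vs} (here refl) = p⊆p∪q (⋃ Vs)
∈⋃⁺ {Vs = U ∷ Vs} (there V∈)  = q⊆p∪q U (⋃ Vs) ∘ ∈⋃⁺ V∈

≼⇒⊆ : {π σ : NC n} → π ≼ σ → ∀ i → blockOf π i ⊆ blockOf σ i
≼⇒⊆ {π = π} {σ} (refines union) i {x} x∈ with union _ (blockOf∈blocks σ i)
... | Vs , Vs⊆ , W≡ with ∈⋃⁻ Vs (subst (i ∈_) W≡ (self (isNCP σ) i))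
... | V , V∈ , i∈V with k , refl ← ∈blocks⇒blockOf π (Vs⊆ V∈)
  = subst (x ∈_) (sym W≡) (∈⋃⁺ V∈ (subst (x ∈_) (same (isNCP π) k i i∈V) x∈))

⊆⇒≼ : {π σ : NC n} → (∀ i → blockOf π i ⊆ blockOf σ i) → π ≼ σ
⊆⇒≼ {π = π} {σ} ⊆σ = refines λ W W∈ → union W (∈blocks⇒blockOf σ W∈)
  where
  union : ∀ W → ∃[ k ] W ≡ blockOf σ k → ∃[ Vs ] (Vs ⊆ˡ blocks π × W ≡ ⋃ Vs)
  union W (k , refl) = Vs , proj₁ ∘ ∈-filter⁻ (_⊆? W) , ⊆-antisym W⊆ ⊆W
    where
    Vs = filter (_⊆? W) (blocks π)
    W⊆ : W ⊆ ⋃ Vs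
    W⊆ {x} x∈ = ∈⋃⁺ (∈-filter⁺ (_⊆? W) (blockOf∈blocks π x)
      (λ {y} y∈ → subst (y ∈_) (same (isNCP σ) k x x∈) (⊆σ x y∈))) (self (isNCP π) x)
    ⊆W : ⋃ Vs ⊆ W
    ⊆W x∈ with V , V∈ , x∈V ← ∈⋃⁻ Vs x∈ = proj₂ (∈-filter⁻ (_⊆? W) {xs = blocks π} V∈) x∈V

_≼?_ : (π σ : NC n) → Dec (π ≼ σ)
π ≼? σ = map′ ⊆⇒≼ ≼⇒⊆ (all? λ i → blockOf π i ⊆? blockOf σ i)

≼-refl : (π : NC n) → π ≼ π
≼-refl π = ⊆⇒≼ λ i x∈ → x∈

≼-trans : {π ρ σ : NC n} → π ≼ ρ → ρ ≼ σ → π ≼ σ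
≼-trans π≼ρ ρ≼σ = ⊆⇒≼ λ i → ≼⇒⊆ ρ≼σ i ∘ ≼⇒⊆ π≼ρ i

𝟙 : NC n
𝟙 {n} = nc (replicate n ⊤) record
  { self        = λ i → subst (i ∈_) (sym (lookup-replicate i ⊤)) ∈⊤
  ; same        = λ i j _ → trans (lookup-replicate j ⊤) (sym (lookup-replicate i ⊤))
  ; nonCrossing = λ i j _ _ _ _ _ _ _ →
                    trans (lookup-replicate i ⊤) (sym (lookup-replicate j ⊤))
  }

≼𝟙 : (π : NC n) → π ≼ 𝟙
≼𝟙 π = ⊆⇒≼ λ i _ → subst (_ ∈_) (sym (lookup-replicate i ⊤)) ∈⊤

-- pos W enumerates the elements p₁ < p₂ < … of W in increasing order.

pos : (W : Subset n) → Fin ∣ W ∣ → Fin n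
pos (inside  ∷ W) zero    = zero
pos (inside  ∷ W) (suc i) = suc (pos W i)
pos (outside ∷ W) i       = suc (pos W i)

pos-mono : (W : Subset n) {i j : Fin ∣ W ∣} → i < j → pos W i < pos W j
pos-mono (inside  ∷ W) {zero}  {suc j} _         = s≤s z≤n
pos-mono (inside  ∷ W) {suc i} {suc j} (s≤s i<j) = s≤s (pos-mono W i<j)
pos-mono (outside ∷ W) i<j                       = s≤s (pos-mono W i<j)

restrictVec : NC n → (W : Subset n) → Vec (Subset ∣ W ∣) ∣ W ∣
restrictVec π W = tabulate λ i → tabulate λ j → lookup (blockOf π (pos W i)) (pos W j)

module _ (π : NC n) (W : Subset n) where

  private
    R = restrictVec π W
    lookup-R : ∀ i → lookup R i ≡ tabulate λ j → lookup (blockOf π (pos W i)) (pos W j)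
    lookup-R = lookup∘tabulate _

  ∈-restrict⁺ : ∀ {i j} → pos W j ∈ blockOf π (pos W i) → j ∈ lookup R i
  ∈-restrict⁺ {i} {j} pj∈ = lookup⇒[]= j (lookup R i)
    (trans (cong (λ V → lookup V j) (lookup-R i)) (trans (lookup∘tabulate _ j) ([]=⇒lookup pj∈)))

  ∈-restrict⁻ : ∀ {i j} → j ∈ lookup R i → pos W j ∈ blockOf π (pos W i)
  ∈-restrict⁻ {i} {j} j∈ = lookup⇒[]= (pos W j) (blockOf π (pos W i))
    (trans (sym (trans (cong (λ V → lookup V j) (lookup-R i)) (lookup∘tabulate _ j)))
           ([]=⇒lookup j∈))

  restrict-cong : ∀ {i j} → blockOf π (pos W i) ≡ blockOf π (pos W j) → lookup R i ≡ lookup R j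
  restrict-cong {i} {j} eq = trans (lookup-R i)
    (trans (tabulate-cong λ k → cong (λ V → lookup V (pos W k)) eq) (sym (lookup-R j)))

  restrict-isNCP : IsNonCrossingPartition R
  restrict-isNCP = record
    { self        = λ i → ∈-restrict⁺ (self P (pos W i))
    ; same        = λ i j j∈ → restrict-cong (same P (pos W i) (pos W j) (∈-restrict⁻ j∈))
    ; nonCrossing = λ i j k l i<j j<k k<l k∈ l∈ → restrict-cong
        (nonCrossing P (pos W i) (pos W j) (pos W k) (pos W l)
          (pos-mono W i<j) (pos-mono W j<k) (pos-mono W k<l) (∈-restrict⁻ k∈) (∈-restrict⁻ l∈))
    }
    where P = isNCP π

restrict : NC n → (W : Subset n) → NC ∣ W ∣
restrict π W = nc (restrictVec π W) (restrict-isNCP π W)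

allVecs : List A → (n : ℕ) → List (Vec A n)
allVecs xs zero    = [] ∷ []
allVecs xs (suc n) = cartesianProductWith _∷_ xs (allVecs xs n)

toNC : Vec (Subset n) n → Maybe (NC n)
toNC B with isNonCrossingPartition? B
... | yes P = just (nc B P)
... | no  _ = nothing

allNC : (n : ℕ) → List (NC n)
allNC n = mapMaybe toNC (allVecs (allVecs (outside ∷ inside ∷ []) n) n)

record Interval (π σ : NC n) : Set where
  constructor between
  field
    mid    : NC n
    .lower : π ≼ mid
    .upper : mid ≼ σ

open Interval using (mid)

toInterval : (π σ : NC n) → NC n → Maybe (Interval π σ)
toInterval π σ ρ with π ≼? ρ | ρ ≼? σ
... | yes π≼ρ | yes ρ≼σ = just (between ρ π≼ρ ρ≼σ)
... | yes _   | no _    = nothing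
... | no _    | _       = nothing

interval : (π σ : NC n) → List (Interval π σ)
interval {n} π σ = mapMaybe (toInterval π σ) (allNC n)

module _ {f : A → Maybe B} where

  ∈-mapMaybe⁺ : ∀ {x y xs} → f x ≡ just y → x ∈ˡ xs → y ∈ˡ mapMaybe f xs
  ∈-mapMaybe⁺ {xs = x ∷ _} eq (here refl) with just _ ← f x | refl ← eq = here refl
  ∈-mapMaybe⁺ {xs = x ∷ _} eq (there x∈) with f x
  ... | just _  = there (∈-mapMaybe⁺ eq x∈)
  ... | nothing = ∈-mapMaybe⁺ eq x∈

  mapMaybe-unique : (∀ {x y z} → f x ≡ just z → f y ≡ just z → x ≡ y) →
                    ∀ {xs} → Unique xs → Unique (mapMaybe f xs)
  mapMaybe-unique inj []                        = []
  mapMaybe-unique inj {x ∷ xs} (x∉ ∷ u) with f x in eq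
  ... | nothing = mapMaybe-unique inj u
  ... | just z  = fresh x∉ ∷ mapMaybe-unique inj u
    where
    fresh : ∀ {ys} → All (x ≢_) ys → All (z ≢_) (mapMaybe f ys)
    fresh []                = []
    fresh {y ∷ _} (x≢y ∷ q) with f y in eq′
    ... | nothing = fresh q
    ... | just _  = (λ { refl → x≢y (inj eq eq′) }) ∷ fresh q

∈-allVecs : {xs : List A} → (∀ x → x ∈ˡ xs) → (v : Vec A n) → v ∈ˡ allVecs xs n
∈-allVecs all []      = here refl
∈-allVecs all (x ∷ v) = ∈-cartesianProductWith⁺ _∷_ (all x) (∈-allVecs all v)

allVecs-unique : {xs : List A} → Unique xs → ∀ n → Unique (allVecs xs n)
allVecs-unique u zero    = [] ∷ []
allVecs-unique u (suc n) = cartesianProductWith⁺ _∷_ ∷-injective u (allVecs-unique u n)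

toNC-complete : (π : NC n) → toNC (blockVec π) ≡ just π
toNC-complete π with isNonCrossingPartition? (blockVec π)
... | yes _ = refl
... | no ¬P = contradiction (isNCP π) ¬P

toNC-sound : {B : Vec (Subset n) n} {π : NC n} → toNC B ≡ just π → B ≡ blockVec π
toNC-sound {B = B} eq with yes _ ← isNonCrossingPartition? B | refl ← eq = refl

∈-allNC : (π : NC n) → π ∈ˡ allNC n
∈-allNC π = ∈-mapMaybe⁺ (toNC-complete π) (∈-allVecs (∈-allVecs λ where
  false → here refl
  true  → there (here refl)) (blockVec π))

allNC-unique : ∀ n → Unique (allNC n)
allNC-unique n = mapMaybe-unique (λ p q → trans (toNC-sound p) (sym (toNC-sound q)))
  (allVecs-unique (allVecs-unique (((λ ()) ∷ []) ∷ [] ∷ []) n) n)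

module _ {π σ : NC n} where

  mid-injective : {x y : Interval π σ} → mid x ≡ mid y → x ≡ y
  mid-injective {between _ _ _} {between _ _ _} refl = refl

  lower : (x : Interval π σ) → π ≼ mid x
  lower (between ρ l u) = recompute (π ≼? ρ) l

  upper : (x : Interval π σ) → mid x ≼ σ
  upper (between ρ l u) = recompute (ρ ≼? σ) u

  toInterval-complete : (x : Interval π σ) → toInterval π σ (mid x) ≡ just x
  toInterval-complete x with π ≼? mid x | mid x ≼? σ
  ... | yes _ | yes _ = refl
  ... | yes _ | no ¬u = contradiction (upper x) ¬u
  ... | no ¬l | _     = contradiction (lower x) ¬l

  toInterval-sound : ∀ {ρ x} → toInterval π σ ρ ≡ just x → ρ ≡ mid x
  toInterval-sound {ρ} eq with yes _ ← π ≼? ρ | yes _ ← ρ ≼? σ | refl ← eq = refl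

  ∈-interval : (x : Interval π σ) → x ∈ˡ interval π σ
  ∈-interval x = ∈-mapMaybe⁺ (toInterval-complete x) (∈-allNC (mid x))

  interval-unique : Unique (interval π σ)
  interval-unique = mapMaybe-unique
    (λ p q → trans (toInterval-sound p) (sym (toInterval-sound q))) (allNC-unique n)

-- rank, the sum of the squares of the block sizes, is strictly
-- increasing, which bounds the length of chains.

sizes : ∀ {m} → Vec (Subset n) m → ℕ
sizes []      = 0
sizes (V ∷ B) = ∣ V ∣ ℕ.+ sizes B

rank : NC n → ℕ
rank π = sizes (blockVec π)

⊆∧size⇒≡ : (V W : Subset n) → V ⊆ W → ∣ W ∣ ℕ.≤ ∣ V ∣ → V ≡ W
⊆∧size⇒≡ []            []            _   _         = refl
⊆∧size⇒≡ (outside ∷ V) (outside ∷ W) V⊆W W≤V       =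
  cong (outside ∷_) (⊆∧size⇒≡ V W (drop-∷-⊆ V⊆W) W≤V)
⊆∧size⇒≡ (outside ∷ V) (inside  ∷ W) V⊆W W<V       =
  contradiction (p⊆q⇒∣p∣≤∣q∣ (drop-∷-⊆ V⊆W)) (ℕ.<⇒≱ W<V)
⊆∧size⇒≡ (inside  ∷ V) (outside ∷ W) V⊆W _         = contradiction (V⊆W Vec.here) λ ()
⊆∧size⇒≡ (inside  ∷ V) (inside  ∷ W) V⊆W (s≤s W≤V) =
  cong (inside ∷_) (⊆∧size⇒≡ V W (drop-∷-⊆ V⊆W) W≤V)

sizes-mono : ∀ {m} (U V : Vec (Subset n) m) → (∀ i → lookup U i ⊆ lookup V i) →
             sizes U ℕ.≤ sizes V
sizes-mono []      []      _   = z≤n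
sizes-mono (_ ∷ U) (_ ∷ V) U⊆V =
  ℕ.+-mono-≤ (p⊆q⇒∣p∣≤∣q∣ (U⊆V zero)) (sizes-mono U V (U⊆V ∘ suc))

sizes-reflect : ∀ {m} (U V : Vec (Subset n) m) → (∀ i → lookup U i ⊆ lookup V i) →
                sizes V ℕ.≤ sizes U → U ≡ V
sizes-reflect []      []      _   _   = refl
sizes-reflect (P ∷ U) (Q ∷ V) U⊆V V≤U = cong₂ _∷_
  (⊆∧size⇒≡ P Q (U⊆V zero) (ℕ.≮⇒≥ λ P<Q →
    ℕ.<⇒≱ (ℕ.+-mono-<-≤ P<Q (sizes-mono U V (U⊆V ∘ suc))) V≤U))
  (sizes-reflect U V (U⊆V ∘ suc) (ℕ.≮⇒≥ λ U<V →
    ℕ.<⇒≱ (ℕ.+-mono-≤-< (p⊆q⇒∣p∣≤∣q∣ (U⊆V zero)) U<V) V≤U))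

rank-mono : {π σ : NC n} → π ≼ σ → rank π ℕ.≤ rank σ
rank-mono {π = π} {σ} π≼σ = sizes-mono (blockVec π) (blockVec σ) (≼⇒⊆ π≼σ)

rank-strict : {π σ : NC n} → π ≼ σ → π ≢ σ → rank π ℕ.< rank σ
rank-strict {π = π} {σ} π≼σ π≢σ = ℕ.≰⇒> λ σ≤π →
  π≢σ (nc-injective (sizes-reflect (blockVec π) (blockVec σ) (≼⇒⊆ π≼σ) σ≤π))

≼-antisym : {π σ : NC n} → π ≼ σ → σ ≼ π → π ≡ σ
≼-antisym {π = π} {σ} π≼σ σ≼π =
  nc-injective (sizes-reflect (blockVec π) (blockVec σ) (≼⇒⊆ π≼σ) (rank-mono σ≼π))

record NC² : Set where
  constructor pair
  field
    {size}       : ℕ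
    .{{size≢0}}  : NonZero size
    fine coarse  : NC size
    .fine≼coarse : fine ≼ coarse

-- The pair (π_W , 1_{|W|}), for W a block of σ.

blockPair : (π σ : NC n) {W : Subset n} → W ∈ˡ blocks σ → NC²
blockPair π σ {W} W∈σ =
  pair {{block-nonZero σ W∈σ}} (restrict π W) 𝟙 (≼𝟙 (restrict π W))

module _ (M : Monoid c ℓ) where

  open Monoid M
  open SetoidReasoning setoid

  monoidWithRightInverses⇒group :
    (_⁻¹ : Carrier → Carrier) → (∀ x → x ∙ (x ⁻¹) ≈ ε) → Group c ℓ
  monoidWithRightInverses⇒group _⁻¹ inverseʳ = record
    { isGroup = record
      { isMonoid = isMonoid
      ; inverse  = inverseˡ , inverseʳ
      ; ⁻¹-cong  = ⁻¹-cong
      }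
    }
    where
    inverseˡ : ∀ x → (x ⁻¹) ∙ x ≈ ε
    inverseˡ x = let y = x ⁻¹ ; z = y ⁻¹ in begin
      y ∙ x              ≈⟨ identityʳ _ ⟨
      (y ∙ x) ∙ ε        ≈⟨ ∙-congˡ (inverseʳ y) ⟨
      (y ∙ x) ∙ (y ∙ z)  ≈⟨ assoc y x _ ⟩
      y ∙ (x ∙ (y ∙ z))  ≈⟨ ∙-congˡ (assoc x y z) ⟨
      y ∙ ((x ∙ y) ∙ z)  ≈⟨ ∙-congˡ (∙-congʳ (inverseʳ x)) ⟩
      y ∙ (ε ∙ z)        ≈⟨ ∙-congˡ (identityˡ z) ⟩
      y ∙ z              ≈⟨ inverseʳ y ⟩
      ε                  ∎

    ⁻¹-cong : ∀ {x y} → x ≈ y → (x ⁻¹) ≈ (y ⁻¹)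
    ⁻¹-cong {x} {y} x≈y = let x′ = x ⁻¹ ; y′ = y ⁻¹ in begin
      x′             ≈⟨ identityʳ _ ⟨
      x′ ∙ ε         ≈⟨ ∙-congˡ (inverseʳ y) ⟨
      x′ ∙ (y ∙ y′)  ≈⟨ assoc _ y _ ⟨
      (x′ ∙ y) ∙ y′  ≈⟨ ∙-congʳ (∙-congˡ x≈y) ⟨
      (x′ ∙ x) ∙ y′  ≈⟨ ∙-congʳ (inverseˡ x) ⟩
      ε ∙ y′         ≈⟨ identityˡ _ ⟩
      y′             ∎

-- Subsets of a setoid have to respect its equality.

record IsSubgroup (G : Group c ℓ) (P : Pred (Group.Carrier G) p) : Set (c ⊔ ℓ ⊔ p) where
  open Group G
  field
    resp      : P Respects _≈_
    ε-closed  : P ε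
    ∙-closed  : ∀ {x y} → P x → P y → P (x ∙ y)
    ⁻¹-closed : ∀ {x} → P x → P (x ⁻¹)

-- The scalars are an arbitrary commutative ring R; the case of interest
-- is R = ℂ, which the standard library does not provide.

module _ (R : CommutativeRing c ℓ) where

  open CommutativeRing R
    using (_≈_; reflexive; _+_; _*_; _-_; 0#; 1#; setoid; +-cong; +-congˡ; +-congʳ; *-cong; *-congˡ;
           *-congʳ; +-identityˡ; +-identityʳ; *-identityˡ; *-identityʳ; zeroˡ; zeroʳ; distribˡ;
           distribʳ; *-assoc; -‿inverseʳ; -‿inverseˡ; -‿cong; +-assoc; +-comm;
           +-commutativeSemigroup; ring)
    renaming (Carrier to C; refl to ≈-refl; sym to ≈-sym; trans to ≈-trans)
  open SetoidReasoning setoid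
  open RingProperties ring using (+-cancelʳ)
  open CommutativeSemigroupProperties +-commutativeSemigroup using (interchange)

  ∑ : List A → (A → C) → C
  ∑ xs f = foldr _+_ 0# (map f xs)

  ∏ : List C → C
  ∏ = foldr _*_ 1#

  convolutionTerm : (NC² → C) → (NC² → C) →
                    {π σ : NC n} .{{_ : NonZero n}} → Interval π σ → C
  convolutionTerm f g {π} {σ} (between ρ π≼ρ ρ≼σ) = f (pair π ρ π≼ρ) * g (pair ρ σ ρ≼σ)

  infixl 7 _⋆_

  _⋆_ : (NC² → C) → (NC² → C) → (NC² → C)
  (f ⋆ g) (pair π σ _) = ∑ (interval π σ) (convolutionTerm f g)

  e : NC² → C
  e (pair π σ _) = if does (π ≟ᴺ σ) then 1# else 0#

  Unital : (NC² → C) → Set ℓ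
  Unital f = ∀ {n} .{{_ : NonZero n}} (π : NC n) → f (pair π π (≼-refl π)) ≈ 1#

  SemiMultiplicative : (NC² → C) → Set ℓ
  SemiMultiplicative g = ∀ {n} .{{_ : NonZero n}} (π σ : NC n) (π≼σ : π ≼ σ) →
    g (pair π σ π≼σ) ≈ ∏ (mapWith∈ (blocks σ) λ W∈σ → g (blockPair π σ W∈σ))

  record IsUnitizedSemiMultiplicative (g : NC² → C) : Set ℓ where
    field
      unital             : Unital g
      semiMultiplicative : SemiMultiplicative g

  record 𝓕 : Set (c ⊔ ℓ) where
    field
      fun    : NC² → C
      unital : Unital fun

  open 𝓕

  infix 4 _≐_

  _≐_ : (f g : NC² → C) → Set ℓ
  f ≐ g = ∀ x → f x ≈ g x

  private variable
    F G : A → C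

  ∑-cong : (xs : List A) → (∀ x → F x ≈ G x) → ∑ xs F ≈ ∑ xs G
  ∑-cong []       F≈G = ≈-refl
  ∑-cong (x ∷ xs) F≈G = +-cong (F≈G x) (∑-cong xs F≈G)

  ∑-zero : (xs : List A) → (∀ x → F x ≈ 0#) → ∑ xs F ≈ 0#
  ∑-zero []       F≈0 = ≈-refl
  ∑-zero (x ∷ xs) F≈0 = ≈-trans (+-cong (F≈0 x) (∑-zero xs F≈0)) (+-identityˡ 0#)

  ∑-+ : (xs : List A) → ∑ xs (λ x → F x + G x) ≈ ∑ xs F + ∑ xs G
  ∑-+ []       = ≈-sym (+-identityˡ 0#)
  ∑-+ (x ∷ xs) = ≈-trans (+-congˡ (∑-+ xs)) (interchange _ _ _ _)

  ∑-*ˡ : (xs : List A) (a : C) → a * ∑ xs F ≈ ∑ xs (λ x → a * F x)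
  ∑-*ˡ []       a = zeroʳ a
  ∑-*ˡ (x ∷ xs) a = ≈-trans (distribˡ a _ _) (+-congˡ (∑-*ˡ xs a))

  ∑-*ʳ : (xs : List A) (a : C) → ∑ xs F * a ≈ ∑ xs (λ x → F x * a)
  ∑-*ʳ []       a = zeroˡ a
  ∑-*ʳ (x ∷ xs) a = ≈-trans (distribʳ a _ _) (+-congˡ (∑-*ʳ xs a))

  ∑-swap : (xs : List A) (ys : List B) (H : A → B → C) →
           ∑ xs (λ x → ∑ ys (H x)) ≈ ∑ ys (λ y → ∑ xs λ x → H x y)
  ∑-swap []       ys H = ≈-sym (∑-zero ys λ _ → ≈-refl)
  ∑-swap (x ∷ xs) ys H = ≈-trans (+-congˡ (∑-swap xs ys H)) (≈-sym (∑-+ ys))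

  ∑-zero∈ : (xs : List A) → (∀ {x} → x ∈ˡ xs → F x ≈ 0#) → ∑ xs F ≈ 0#
  ∑-zero∈ []       F≈0 = ≈-refl
  ∑-zero∈ (x ∷ xs) F≈0 =
    ≈-trans (+-cong (F≈0 (here refl)) (∑-zero∈ xs (F≈0 ∘ there))) (+-identityˡ 0#)

  ∑-single : {xs : List A} {x : A} → Unique xs → x ∈ˡ xs →
             (∀ y → y ≢ x → F y ≈ 0#) → ∑ xs F ≈ F x
  ∑-single {xs = x ∷ xs} (x∉ ∷ _) (here refl) F≈0 = ≈-trans
    (+-congˡ (∑-zero∈ xs λ y∈ → F≈0 _ λ { refl → All.lookup x∉ y∈ refl })) (+-identityʳ _)
  ∑-single (y∉ ∷ u) (there x∈) F≈0 = ≈-trans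
    (+-cong (F≈0 _ (All.lookup y∉ x∈)) (∑-single u x∈ F≈0)) (+-identityˡ _)

  ∑-interval : {π σ : NC n} {F : Interval π σ → C} (x : Interval π σ) → (∀ y → mid y ≢ mid x → F y ≈ 0#) →
               ∑ (interval π σ) F ≈ F x
  ∑-interval x F≈0 =
    ∑-single interval-unique (∈-interval x) λ y y≢x → F≈0 y (y≢x ∘ mid-injective)

  ∑-mapMaybe : {F : B → C} (f : A → Maybe B) (xs : List A) →
               ∑ (mapMaybe f xs) F ≈ ∑ xs (λ x → maybe′ F 0# (f x))
  ∑-mapMaybe f []       = ≈-refl
  ∑-mapMaybe f (x ∷ xs) with f x
  ... | just _  = +-congˡ (∑-mapMaybe f xs)
  ... | nothing = ≈-trans (∑-mapMaybe f xs) (≈-sym (+-identityˡ _))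

  e-refl : {π : NC n} .{{_ : NonZero n}} .(π≼π : π ≼ π) → e (pair π π π≼π) ≈ 1#
  e-refl {π = π} _ =
    reflexive (cong (if_then 1# else 0#) (dec-true (π ≟ᴺ π) refl))

  e-≢ : {π σ : NC n} .{{_ : NonZero n}} .(π≼σ : π ≼ σ) → π ≢ σ → e (pair π σ π≼σ) ≈ 0#
  e-≢ {π = π} {σ} _ π≢σ =
    reflexive (cong (if_then 1# else 0#) (dec-false (π ≟ᴺ σ) π≢σ))

  ⋆-cong : {f f′ g g′ : NC² → C} → f ≐ f′ → g ≐ g′ → f ⋆ g ≐ f′ ⋆ g′
  ⋆-cong f≈ g≈ (pair π σ _) = ∑-cong (interval π σ) λ _ → *-cong (f≈ _) (g≈ _)

  ⋆-identityˡ : (f : NC² → C) → e ⋆ f ≐ f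
  ⋆-identityˡ f (pair π σ π≼σ) = ≈-trans
    (∑-interval (between π (≼-refl π) π≼σ)
      λ y ρ≢π → ≈-trans (*-congʳ (e-≢ (lower y) (ρ≢π ∘ sym))) (zeroˡ _))
    (≈-trans (*-congʳ (e-refl (≼-refl π))) (*-identityˡ _))

  ⋆-identityʳ : (f : NC² → C) → f ⋆ e ≐ f
  ⋆-identityʳ f (pair π σ π≼σ) = ≈-trans
    (∑-interval (between σ π≼σ (≼-refl σ))
      λ y ρ≢σ → ≈-trans (*-congˡ (e-≢ (upper y) ρ≢σ)) (zeroʳ _))
    (≈-trans (*-congˡ (e-refl (≼-refl σ))) (*-identityʳ _))

  -- Extension by zero turns convolution into matrix multiplication.

  module _ {n} .{{_ : NonZero n}} where

    extend : (NC² → C) → NC n → NC n → C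
    extend f π σ with π ≼? σ
    ... | yes π≼σ = f (pair π σ π≼σ)
    ... | no  _   = 0#

    extend-≼ : (f : NC² → C) {π σ : NC n} (π≼σ : π ≼ σ) → extend f π σ ≈ f (pair π σ π≼σ)
    extend-≼ f {π} {σ} π≼σ with π ≼? σ
    ... | yes _  = ≈-refl
    ... | no π⋠σ = contradiction π≼σ π⋠σ

    extend-⋠ : (f : NC² → C) {π σ : NC n} → ¬ π ≼ σ → extend f π σ ≈ 0#
    extend-⋠ f {π} {σ} π⋠σ with π ≼? σ
    ... | yes π≼σ = contradiction π≼σ π⋠σ
    ... | no _    = ≈-refl

    ⋆-matrix : (f g : NC² → C) (π σ : NC n) .(π≼σ : π ≼ σ) →
               (f ⋆ g) (pair π σ π≼σ) ≈ ∑ (allNC n) (λ ρ → extend f π ρ * extend g ρ σ)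
    ⋆-matrix f g π σ _ = ≈-trans (∑-mapMaybe (toInterval π σ) (allNC n)) (∑-cong (allNC n) term)
      where
      term : ∀ ρ → maybe′ (convolutionTerm f g) 0# (toInterval π σ ρ) ≈
                   extend f π ρ * extend g ρ σ
      term ρ with π ≼? ρ | ρ ≼? σ
      ... | yes _ | yes _ = ≈-refl
      ... | yes _ | no _  = ≈-sym (zeroʳ _)
      ... | no _  | _     = ≈-sym (zeroˡ _)

    extend-⋆ : (f g : NC² → C) (π σ : NC n) →
               extend (f ⋆ g) π σ ≈ ∑ (allNC n) (λ ρ → extend f π ρ * extend g ρ σ)
    extend-⋆ f g π σ with π ≼? σ
    ... | yes π≼σ = ⋆-matrix f g π σ π≼σ
    ... | no  π⋠σ = ≈-sym (∑-zero (allNC n) term)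
      where
      term : ∀ ρ → extend f π ρ * extend g ρ σ ≈ 0#
      term ρ with π ≼? ρ
      ... | no  _   = zeroˡ _
      ... | yes π≼ρ = ≈-trans (*-congˡ (extend-⋠ g (π⋠σ ∘ ≼-trans π≼ρ))) (zeroʳ _)

  ⋆-assoc : (f g h : NC² → C) → (f ⋆ g) ⋆ h ≐ f ⋆ (g ⋆ h)
  ⋆-assoc f g h (pair {n} π σ π≼σ) = begin
    ((f ⋆ g) ⋆ h) (pair π σ π≼σ)
      ≈⟨ ⋆-matrix (f ⋆ g) h π σ π≼σ ⟩
    ∑ N (λ ρ → extend (f ⋆ g) π ρ * extend h ρ σ)
      ≈⟨ ∑-cong N (λ ρ → ≈-trans (*-congʳ (extend-⋆ f g π ρ)) (∑-*ʳ N _)) ⟩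
    ∑ N (λ ρ → ∑ N λ τ → (extend f π τ * extend g τ ρ) * extend h ρ σ)
      ≈⟨ ∑-swap N N _ ⟩
    ∑ N (λ τ → ∑ N λ ρ → (extend f π τ * extend g τ ρ) * extend h ρ σ)
      ≈⟨ ∑-cong N (λ τ → ∑-cong N λ ρ → *-assoc _ _ _) ⟩
    ∑ N (λ τ → ∑ N λ ρ → extend f π τ * (extend g τ ρ * extend h ρ σ))
      ≈⟨ ∑-cong N (λ τ → ≈-trans (*-congˡ (extend-⋆ g h τ σ)) (∑-*ˡ N _)) ⟨
    ∑ N (λ τ → extend f π τ * extend (g ⋆ h) τ σ)
      ≈⟨ ⋆-matrix f (g ⋆ h) π σ π≼σ ⟨
    (f ⋆ (g ⋆ h)) (pair π σ π≼σ) ∎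
    where N = allNC n

  ⋆-unital : {f g : NC² → C} → Unital f → Unital g → Unital (f ⋆ g)
  ⋆-unital f-unital g-unital π = ≈-trans
    (∑-interval (between π (≼-refl π) (≼-refl π))
      λ y ρ≢π → contradiction (≼-antisym (upper y) (lower y)) ρ≢π)
    (≈-trans (*-cong (f-unital π) (g-unital π)) (*-identityˡ 1#))

  -- Iterates of g ↦ e + (e − f) ⋆ g.  For unital f, the value at (π , σ)
  -- no longer changes once the number of steps exceeds rank σ − rank π,
  -- and the limit is a right inverse of f.

  approx : (NC² → C) → ℕ → NC² → C
  approx f zero    x = 0#
  approx f (suc k) x = e x + ((λ y → e y - f y) ⋆ approx f k) x

  inv : (NC² → C) → NC² → C
  inv f x = approx f (suc (rank (NC².coarse x))) x

  module _ {f : NC² → C} (f-unital : Unital f) where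

    private
      d : NC² → C
      d x = e x - f x

      d-refl : {π : NC n} .{{_ : NonZero n}} .(π≼π : π ≼ π) → d (pair π π π≼π) ≈ 0#
      d-refl {π = π} π≼π =
        ≈-trans (+-cong (e-refl π≼π) (-‿cong (f-unital π))) (-‿inverseʳ 1#)

    approx-stable : ∀ k (x : NC²) →
      rank (NC².coarse x) ℕ.< k ℕ.+ rank (NC².fine x) → approx f (suc k) x ≈ approx f k x
    approx-stable zero (pair π σ π≼σ) σ<π =
      contradiction (rank-mono (recompute (π ≼? σ) π≼σ)) (ℕ.<⇒≱ σ<π)
    approx-stable (suc k) (pair π σ π≼σ) σ<k+π = +-congˡ (∑-cong (interval π σ) term)
      where
      term : (y : Interval π σ) →
             convolutionTerm d (approx f (suc k)) y ≈ convolutionTerm d (approx f k) y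
      term y@(between ρ π≼ρ ρ≼σ) with π ≟ᴺ ρ
      ... | yes refl = ≈-trans (vanish _) (≈-sym (vanish _))
        where
        vanish : ∀ a → d (pair π π π≼ρ) * a ≈ 0#
        vanish a = ≈-trans (*-congʳ (d-refl π≼ρ)) (zeroˡ a)
      ... | no π≢ρ   = *-congˡ (approx-stable k (pair ρ σ ρ≼σ)
        (ℕ.<-≤-trans σ<k+π (ℕ.≤-trans (ℕ.≤-reflexive (sym (ℕ.+-suc k (rank π))))
          (ℕ.+-monoʳ-≤ k (rank-strict (lower y) π≢ρ)))))

    inv-unital : Unital (inv f)
    inv-unital π = ≈-trans
      (+-cong (e-refl (≼-refl π)) (≈-trans
        (∑-interval (between π (≼-refl π) (≼-refl π))
          λ y ρ≢π → contradiction (≼-antisym (upper y) (lower y)) ρ≢π)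
        (≈-trans (*-congʳ (d-refl (≼-refl π))) (zeroˡ _))))
      (+-identityʳ 1#)

    ⋆-inverseʳ : f ⋆ inv f ≐ e
    ⋆-inverseʳ x@(pair π σ π≼σ) = +-cancelʳ ((d ⋆ g) x) _ _ (begin
      (f ⋆ g) x + (d ⋆ g) x ≈⟨ ∑-+ (interval π σ) ⟨
      ∑ (interval π σ) (λ y → convolutionTerm f g y + convolutionTerm d g y)
        ≈⟨ ∑-cong (interval π σ) (λ y → ≈-trans (≈-sym (distribʳ _ _ _)) (*-congʳ (f+d≈e _))) ⟩
      (e ⋆ g) x             ≈⟨ ⋆-identityˡ g x ⟩
      g x                   ≈⟨ approx-stable K x (s≤s (ℕ.m≤m+n (rank σ) (rank π))) ⟨
      e x + (d ⋆ g) x       ∎)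
      where
      K = suc (rank σ)
      g = approx f K
      f+d≈e : ∀ y → f y + d y ≈ e y
      f+d≈e y = ≈-trans (+-comm (f y) (d y)) (≈-trans (+-assoc (e y) _ _)
        (≈-trans (+-congˡ (-‿inverseˡ (f y))) (+-identityʳ (e y))))

  𝓕-monoid : Monoid (c ⊔ ℓ) ℓ
  𝓕-monoid = record
    { Carrier  = 𝓕
    ; _≈_      = λ f g → fun f ≐ fun g
    ; _∙_      = λ f g → record
      { fun = fun f ⋆ fun g ; unital = ⋆-unital {fun f} {fun g} (unital f) (unital g) }
    ; ε        = record { fun = e ; unital = λ π → e-refl (≼-refl π) }
    ; isMonoid = record
      { isSemigroup = record
        { isMagma = record
          { isEquivalence = record
            { refl  = λ x → ≈-refl
            ; sym   = λ f≐g x → ≈-sym (f≐g x)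
            ; trans = λ f≐g g≐h x → ≈-trans (f≐g x) (g≐h x)
            }
          ; ∙-cong = λ {f} {f′} {g} {g′} → ⋆-cong {fun f} {fun f′} {fun g} {fun g′}
          }
        ; assoc = λ f g h → ⋆-assoc (fun f) (fun g) (fun h)
        }
      ; identity = (λ f → ⋆-identityˡ (fun f)) , (λ f → ⋆-identityʳ (fun f))
      }
    }

  𝓕-group : Group (c ⊔ ℓ) ℓ
  𝓕-group = monoidWithRightInverses⇒group 𝓕-monoid
    (λ f → record { fun = inv (fun f) ; unital = inv-unital {fun f} (unital f) })
    (λ f → ⋆-inverseʳ {fun f} (unital f))

  𝓖̃ : Pred 𝓕 ℓ
  𝓖̃ g = IsUnitizedSemiMultiplicative (fun g)

-- The interval [π , σ] is the product of the intervals [π_W , 1] over the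
-- blocks W of σ.  Distributing the product over the sums therefore shows
-- that a convolution of semi-multiplicative functions is again
-- semi-multiplicative.  For the inverse h of g, let h′ be the
-- semi-multiplicative function with h′ (π , 1ₙ) = h (π , 1ₙ).  Only
-- these values enter into (g ⋆ h′) (π , 1ₙ), so the semi-multiplicative
-- functions g ⋆ h′ and e agree on all pairs (π , 1ₙ), hence are equal, and
-- h = h′.

module Submission where

open import Defs
open import Algebra.Bundles using (CommutativeMonoid; CommutativeRing; Group)
import Algebra.Properties.CommutativeSemigroup as CommutativeSemigroupProperties
open import Data.Fin.Base using (Fin; zero; suc; _<_; cast)
open import Data.Fin.Properties using (<-cmp; <-trans; <-irrefl; suc-injective; cast-is-id)
open import Data.Fin.Subset using (Subset; inside; outside; _∈_; _⊆_; ⊤; ∣_∣)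
open import Data.Fin.Subset.Properties using (∈⊤; ⊆-antisym; ∣⊤∣≡n)
open import Data.List.Base
  using (List; []; _∷_; foldr; map; _++_; concatMap; cartesianProductWith)
open import Data.List.Membership.DecPropositional using (_∈?_)
open import Data.List.Membership.Propositional using (mapWith∈; find; lose) renaming (_∈_ to _∈ˡ_)
open import Data.List.Membership.Propositional.Properties
  using (∈-map⁺; ∈-map⁻; ∈-concatMap⁺; ∈-concatMap⁻; ∈-cartesianProductWith⁺; mapWith∈-cong;
         mapWith∈≗map)
open import Data.List.Membership.Propositional.Properties.WithK
  using (unique∧set⇒bag; unique⇒irrelevant)
open import Data.List.Properties using (map-∘)
open import Data.List.Relation.Binary.BagAndSetEquality using (∼bag⇒↭)
open import Data.List.Relation.Binary.Disjoint.Propositional using (Disjoint)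
open import Data.List.Relation.Binary.Permutation.Propositional using (_↭_; ↭⇒↭ₛ′)
open import Data.List.Relation.Binary.Permutation.Propositional.Properties
  using (map⁺; ↭-singleton-inv)
import Data.List.Relation.Binary.Permutation.Setoid.Properties as Permutation
open import Data.List.Relation.Binary.Subset.Propositional using () renaming (_⊆_ to _⊆ˡ_)
open import Data.List.Relation.Unary.All as All using (All; []; _∷_)
import Data.List.Relation.Unary.All.Properties as All
open import Data.List.Relation.Unary.AllPairs using (AllPairs; []; _∷_)
import Data.List.Relation.Unary.AllPairs.Properties as AllPairs
open import Data.List.Relation.Unary.Any as Any using (Any; here; there)
open import Data.List.Relation.Unary.Unique.DecPropositional.Properties using (deduplicate-!)
open import Data.List.Relation.Unary.Unique.Propositional using (Unique)
import Data.List.Relation.Unary.Unique.Propositional.Properties as Unique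
open import Data.Nat.Base using (ℕ; zero; suc; NonZero)
open import Data.Product.Base using (∃-syntax; _,_; proj₁)
open import Data.Vec.Base as Vec using (Vec; []; _∷_; lookup; tabulate; toList)
open import Data.Vec.Properties
  using (lookup∘tabulate; tabulate-cong; tabulate∘lookup; []=⇒lookup; lookup⇒[]=; lookup-replicate)
open import Function.Base using (_∘_)
open import Function.Bundles using (mk⇔)
open import Level using (Level)
open import Relation.Binary.Definitions using (tri<; tri≈; tri>)
open import Relation.Binary.PropositionalEquality
  using (_≡_; _≢_; refl; sym; trans; cong; cong₂; subst; module ≡-Reasoning)
import Relation.Binary.Reasoning.Setoid as SetoidReasoning
open import Relation.Nullary using (yes; no; contradiction)
open import Relation.Nullary.Decidable using (recompute)

open IsNonCrossingPartition
open NC using (blockVec)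
open Interval using (mid)

private variable
  m n : ℕ
  a b d t c ℓ : Level
  A : Set a
  B : Set b
  D : Set d

-- Subsets of a subset

pos∈ : (W : Subset n) (k : Fin ∣ W ∣) → pos W k ∈ W
pos∈ (inside  ∷ W) zero    = Vec.here
pos∈ (inside  ∷ W) (suc k) = Vec.there (pos∈ W k)
pos∈ (outside ∷ W) k       = Vec.there (pos∈ W k)

pos-surjective : (W : Subset n) {i : Fin n} → i ∈ W → ∃[ k ] i ≡ pos W k
pos-surjective (inside  ∷ W) Vec.here = zero , refl
pos-surjective (inside  ∷ W) (Vec.there i∈W) with k , refl ← pos-surjective W i∈W = suc k , refl
pos-surjective (outside ∷ W) (Vec.there i∈W) with k , refl ← pos-surjective W i∈W = k , refl

pos-injective : (W : Subset n) {j k : Fin ∣ W ∣} → pos W j ≡ pos W k → j ≡ k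
pos-injective (inside  ∷ W) {zero}  {zero}  _  = refl
pos-injective (inside  ∷ W) {suc j} {suc k} eq = cong suc (pos-injective W (suc-injective eq))
pos-injective (outside ∷ W) eq                 = pos-injective W (suc-injective eq)

-- For gluing: four crossing positions in `W` must come from four indices that cross in the same
-- way.
pos-cancel-< : (W : Subset n) {j k : Fin ∣ W ∣} → pos W j < pos W k → j < k
pos-cancel-< W {j} {k} pj<pk with <-cmp j k
... | tri< j<k _ _  = j<k
... | tri≈ _ refl _ = contradiction pj<pk (<-irrefl refl)
... | tri> _ _ k<j  = contradiction (<-trans pj<pk (pos-mono W k<j)) (<-irrefl refl)

-- The image of `V` under `pos W`, undoing the relabelling made by a restriction to `W`.
embed : (W : Subset n) → Subset ∣ W ∣ → Subset n
embed []            []      = []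
embed (inside  ∷ W) (v ∷ V) = v ∷ embed W V
embed (outside ∷ W) V       = outside ∷ embed W V

lookup-embed : (W : Subset n) (V : Subset ∣ W ∣) (k : Fin ∣ W ∣) →
               lookup (embed W V) (pos W k) ≡ lookup V k
lookup-embed (inside  ∷ W) (v ∷ V) zero    = refl
lookup-embed (inside  ∷ W) (v ∷ V) (suc k) = lookup-embed W V k
lookup-embed (outside ∷ W) V       k       = lookup-embed W V k

embed-⊆ : (W : Subset n) (V : Subset ∣ W ∣) → embed W V ⊆ W
embed-⊆ (inside  ∷ W) (_ ∷ V) Vec.here       = Vec.here
embed-⊆ (inside  ∷ W) (_ ∷ V) (Vec.there i∈) = Vec.there (embed-⊆ W V i∈)
embed-⊆ (outside ∷ W) V       (Vec.there i∈) = Vec.there (embed-⊆ W V i∈)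

-- `V` can be read off from `embed W V` at the positions of `W`.
embed-injective : (W : Subset n) {U V : Subset ∣ W ∣} → embed W U ≡ embed W V → U ≡ V
embed-injective W {U} {V} eq = begin
  U                                      ≡⟨ tabulate∘lookup U ⟨
  tabulate (lookup U)                    ≡⟨ tabulate-cong (lookup-embed W U) ⟨
  tabulate (lookup (embed W U) ∘ pos W)  ≡⟨ cong (λ S → tabulate (lookup S ∘ pos W)) eq ⟩
  tabulate (lookup (embed W V) ∘ pos W)  ≡⟨ tabulate-cong (lookup-embed W V) ⟩
  tabulate (lookup V)                    ≡⟨ tabulate∘lookup V ⟩
  V                                      ∎
  where open ≡-Reasoning

module _ (W : Subset n) {V : Subset ∣ W ∣} where

  ∈-embed⁺ : ∀ {k} → k ∈ V → pos W k ∈ embed W V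
  ∈-embed⁺ {k} k∈ = lookup⇒[]= _ _ (trans (lookup-embed W V k) ([]=⇒lookup k∈))

  ∈-embed⁻ : ∀ {k} → pos W k ∈ embed W V → k ∈ V
  ∈-embed⁻ {k} k∈ = lookup⇒[]= _ _ (trans (sym (lookup-embed W V k)) ([]=⇒lookup k∈))

∣embed∣ : (W : Subset n) (V : Subset ∣ W ∣) → ∣ V ∣ ≡ ∣ embed W V ∣
∣embed∣ []            []            = refl
∣embed∣ (inside  ∷ W) (inside  ∷ V) = cong suc (∣embed∣ W V)
∣embed∣ (inside  ∷ W) (outside ∷ V) = ∣embed∣ W V
∣embed∣ (outside ∷ W) V             = ∣embed∣ W V

-- Both sides enumerate the same set in increasing order. This is why restricting in two stages
-- agrees with restricting once.
pos-embed : (W : Subset n) (V : Subset ∣ W ∣) (k : Fin ∣ V ∣) →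
            pos (embed W V) (cast (∣embed∣ W V) k) ≡ pos W (pos V k)
pos-embed []            []            ()
pos-embed (inside  ∷ W) (inside  ∷ V) zero    = refl
pos-embed (inside  ∷ W) (inside  ∷ V) (suc k) = cong suc (pos-embed W V k)
pos-embed (inside  ∷ W) (outside ∷ V) k       = cong suc (pos-embed W V k)
pos-embed (outside ∷ W) V             k       = cong suc (pos-embed W V k)

pos-⊤ : (k : Fin ∣ ⊤ {n} ∣) → pos ⊤ k ≡ cast (∣⊤∣≡n n) k
pos-⊤ {suc n} zero    = refl
pos-⊤ {suc n} (suc k) = cong suc (pos-⊤ k)

-- Gluing partitions of the blocks of a partition

vec-ext : {u v : Vec A n} → (∀ i → lookup u i ≡ lookup v i) → u ≡ v
vec-ext {u = u} {v} eq =
  trans (sym (tabulate∘lookup u)) (trans (tabulate-cong eq) (tabulate∘lookup v))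

NC-ext : {π ρ : NC n} → (∀ i j → lookup (blockOf π i) j ≡ lookup (blockOf ρ i) j) → π ≡ ρ
NC-ext eq = nc-injective (vec-ext λ i → vec-ext (eq i))

blockOf-𝟙 : (i : Fin n) → blockOf 𝟙 i ≡ ⊤
blockOf-𝟙 i = lookup-replicate i ⊤

block-≡ : (σ : NC n) {W : Subset n} {i : Fin n} → W ∈ˡ blocks σ → i ∈ W → blockOf σ i ≡ W
block-≡ σ {i = i} W∈σ i∈W with k , refl ← ∈blocks⇒blockOf σ W∈σ = same (isNCP σ) k i i∈W

blocks-unique : (σ : NC n) → Unique (blocks σ)
blocks-unique σ = deduplicate-! _≟ˢ_ (toList (blockVec σ))

lookup-restrict : (π : NC n) (W : Subset n) (i j : Fin ∣ W ∣) →
                  lookup (blockOf (restrict π W) i) j ≡ lookup (blockOf π (pos W i)) (pos W j)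
lookup-restrict π W i j =
  trans (cong (λ V → lookup V j) (lookup∘tabulate _ i)) (lookup∘tabulate _ j)

restrict-mono : {π ρ : NC n} (W : Subset n) → π ≼ ρ → restrict π W ≼ restrict ρ W
restrict-mono {π = π} {ρ} W π≼ρ = ⊆⇒≼ λ i j∈ →
  ∈-restrict⁺ ρ W (≼⇒⊆ π≼ρ (pos W i) (∈-restrict⁻ π W j∈))

module _ {ρ σ : NC n} (ρ≼σ : ρ ≼ σ) {W : Subset n} (W∈σ : W ∈ˡ blocks σ) where

  -- Since ρ ≼ σ, the block `W` of σ is a union of blocks of ρ, so restricting to `W` cuts no block
  -- of ρ that meets `W`.
  embed-block : ∀ k → embed W (blockOf (restrict ρ W) k) ≡ blockOf ρ (pos W k)
  embed-block k = ⊆-antisym left right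
    where
    left : embed W (blockOf (restrict ρ W) k) ⊆ blockOf ρ (pos W k)
    left j∈ with j , refl ← pos-surjective W (embed-⊆ W _ j∈) = ∈-restrict⁻ ρ W (∈-embed⁻ W j∈)
    right : blockOf ρ (pos W k) ⊆ embed W (blockOf (restrict ρ W) k)
    right j∈ with j , refl ← pos-surjective W
      (subst (_ ∈_) (block-≡ σ W∈σ (pos∈ W k)) (≼⇒⊆ ρ≼σ (pos W k) j∈))
      = ∈-embed⁺ W (∈-restrict⁺ ρ W j∈)

-- Each block of π or ρ lies in a block `W` of σ and is recovered by embedding the corresponding
-- block of the restriction to `W`.
restrict-reflects-≡ : {π ρ σ : NC n} → π ≼ σ → ρ ≼ σ →
                      (∀ {W} → W ∈ˡ blocks σ → restrict π W ≡ restrict ρ W) → π ≡ ρ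
restrict-reflects-≡ {π = π} {ρ} {σ} π≼σ ρ≼σ eq = nc-injective (vec-ext go)
  where
  go : ∀ i → blockOf π i ≡ blockOf ρ i
  go i with k , i≡ ← pos-surjective (blockOf σ i) (self (isNCP σ) i) = begin
    blockOf π i                             ≡⟨ cong (blockOf π) i≡ ⟩
    blockOf π (pos W k)                     ≡⟨ embed-block π≼σ W∈σ k ⟨
    embed W (blockOf (restrict π W) k)      ≡⟨ cong (λ τ → embed W (blockOf τ k)) (eq W∈σ) ⟩
    embed W (blockOf (restrict ρ W) k)      ≡⟨ embed-block ρ≼σ W∈σ k ⟩
    blockOf ρ (pos W k)                     ≡⟨ cong (blockOf ρ) i≡ ⟨
    blockOf ρ i                             ∎
    where
    open ≡-Reasoning
    W = blockOf σ i
    W∈σ = blockOf∈blocks σ i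

-- The inverse of restricting to all blocks of σ. The family `τ` is indexed by all subsets, so that
-- the glued vector can be written without membership proofs.
module Glue (σ : NC n) (τ : (W : Subset n) → NC ∣ W ∣) where

  private
    gluedBlock : Fin n → Subset n
    gluedBlock i =
      embed W (blockOf (τ W) (proj₁ (pos-surjective W (self (isNCP σ) i))))
      where W = blockOf σ i

    gluedVec : Vec (Subset n) n
    gluedVec = tabulate gluedBlock

    gluedVec-⊆ : ∀ i → lookup gluedVec i ⊆ blockOf σ i
    gluedVec-⊆ i j∈ = embed-⊆ (blockOf σ i) _ (subst (_ ∈_) (lookup∘tabulate gluedBlock i) j∈)

    module _ {W : Subset n} (W∈σ : W ∈ˡ blocks σ) where

      lookup-gluedVec : ∀ k → lookup gluedVec (pos W k) ≡ embed W (blockOf (τ W) k)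
      lookup-gluedVec k =
        trans (lookup∘tabulate gluedBlock (pos W k)) (go _ refl (block-≡ σ W∈σ (pos∈ W k)))
        where
        -- The position is generalised to `i`: `W` occurs in `pos W k`, so `blockOf σ (pos W k) ≡ W`
        -- could not be matched with `refl`.
        go : ∀ i → pos W k ≡ i → blockOf σ i ≡ W → gluedBlock i ≡ embed W (blockOf (τ W) k)
        go i pk≡i refl with pos-surjective W (self (isNCP σ) i)
        ... | k′ , i≡pk′ with refl ← pos-injective W (trans pk≡i i≡pk′) = refl

      ∈-gluedVec⁺ : ∀ {j k} → j ∈ blockOf (τ W) k → pos W j ∈ lookup gluedVec (pos W k)
      ∈-gluedVec⁺ {k = k} j∈ = subst (_ ∈_) (sym (lookup-gluedVec k)) (∈-embed⁺ W j∈)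

      ∈-gluedVec⁻ : ∀ {j k} → pos W j ∈ lookup gluedVec (pos W k) → j ∈ blockOf (τ W) k
      ∈-gluedVec⁻ {k = k} j∈ = ∈-embed⁻ W (subst (_ ∈_) (lookup-gluedVec k) j∈)

      gluedVec-cong : ∀ {j k} → blockOf (τ W) j ≡ blockOf (τ W) k →
                      lookup gluedVec (pos W j) ≡ lookup gluedVec (pos W k)
      gluedVec-cong {j} {k} eq =
        trans (lookup-gluedVec j) (trans (cong (embed W) eq) (sym (lookup-gluedVec k)))

    glued-self : ∀ i → i ∈ lookup gluedVec i
    glued-self i = go (pos-surjective W (self (isNCP σ) i))
      where
      W = blockOf σ i
      go : ∀ {i} → ∃[ p ] i ≡ pos W p → i ∈ lookup gluedVec i
      go (p , refl) = ∈-gluedVec⁺ (blockOf∈blocks σ i) (self (isNCP (τ W)) p)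

    glued-same : ∀ i j → j ∈ lookup gluedVec i → lookup gluedVec j ≡ lookup gluedVec i
    glued-same i j j∈ =
      go (pos-surjective W (self (isNCP σ) i)) (pos-surjective W (gluedVec-⊆ i j∈)) j∈
      where
      W = blockOf σ i
      W∈σ = blockOf∈blocks σ i
      go : ∀ {i j} → ∃[ p ] i ≡ pos W p → ∃[ q ] j ≡ pos W q → j ∈ lookup gluedVec i →
           lookup gluedVec j ≡ lookup gluedVec i
      go (p , refl) (q , refl) j∈ =
        gluedVec-cong W∈σ (same (isNCP (τ W)) p q (∈-gluedVec⁻ W∈σ j∈))

    -- Glued blocks lie inside blocks of σ. As σ is non-crossing, i, j, k and l all lie in one block
    -- `W` of σ, and there `τ W` is non-crossing.
    glued-nonCrossing : ∀ i j k l → i < j → j < k → k < l →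
                        k ∈ lookup gluedVec i → l ∈ lookup gluedVec j →
                        lookup gluedVec i ≡ lookup gluedVec j
    glued-nonCrossing i j k l i<j j<k k<l k∈ l∈ =
      go (pos-surjective W (self (isNCP σ) i))
         (pos-surjective W (subst (j ∈_) (sym W≡) (self (isNCP σ) j)))
         (pos-surjective W (gluedVec-⊆ i k∈))
         (pos-surjective W (subst (l ∈_) (sym W≡) (gluedVec-⊆ j l∈)))
         i<j j<k k<l k∈ l∈
      where
      W = blockOf σ i
      W∈σ = blockOf∈blocks σ i
      W≡ : W ≡ blockOf σ j
      W≡ = nonCrossing (isNCP σ) i j k l i<j j<k k<l (gluedVec-⊆ i k∈) (gluedVec-⊆ j l∈)
      go : ∀ {i j k l} → ∃[ p ] i ≡ pos W p → ∃[ q ] j ≡ pos W q →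
           ∃[ r ] k ≡ pos W r → ∃[ s ] l ≡ pos W s → i < j → j < k → k < l →
           k ∈ lookup gluedVec i → l ∈ lookup gluedVec j →
           lookup gluedVec i ≡ lookup gluedVec j
      go (p , refl) (q , refl) (r , refl) (s , refl) i<j j<k k<l k∈ l∈ =
        gluedVec-cong W∈σ (nonCrossing (isNCP (τ W)) p q r s
          (pos-cancel-< W i<j) (pos-cancel-< W j<k) (pos-cancel-< W k<l)
          (∈-gluedVec⁻ W∈σ k∈) (∈-gluedVec⁻ W∈σ l∈))

  glue : NC n
  glue = nc gluedVec record
    { self = glued-self ; same = glued-same ; nonCrossing = glued-nonCrossing }

  restrict-glue : ∀ {W} → W ∈ˡ blocks σ → restrict glue W ≡ τ W
  restrict-glue {W} W∈σ = NC-ext λ i j → begin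
    lookup (blockOf (restrict glue W) i) j
      ≡⟨ lookup-restrict glue W i j ⟩
    lookup (lookup gluedVec (pos W i)) (pos W j)
      ≡⟨ cong (λ V → lookup V (pos W j)) (lookup-gluedVec W∈σ i) ⟩
    lookup (embed W (blockOf (τ W) i)) (pos W j)
      ≡⟨ lookup-embed W _ j ⟩
    lookup (blockOf (τ W) i) j ∎
    where open ≡-Reasoning

  glue-≼ : glue ≼ σ
  glue-≼ = ⊆⇒≼ gluedVec-⊆

  ≼-glue : {π : NC n} → π ≼ σ → (∀ {W} → W ∈ˡ blocks σ → restrict π W ≼ τ W) → π ≼ glue
  ≼-glue {π} π≼σ π≼τ = ⊆⇒≼ λ i x∈ →
    go i (pos-surjective _ (self (isNCP σ) i)) (pos-surjective _ (≼⇒⊆ π≼σ i x∈)) x∈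
    where
    go : ∀ i₀ {i x} → let W = blockOf σ i₀ in ∃[ p ] i ≡ pos W p → ∃[ q ] x ≡ pos W q →
         x ∈ blockOf π i → x ∈ blockOf glue i
    go i₀ (p , refl) (q , refl) x∈ =
      ∈-gluedVec⁺ W∈σ (≼⇒⊆ (π≼τ W∈σ) p (∈-restrict⁺ π (blockOf σ i₀) x∈))
      where W∈σ = blockOf∈blocks σ i₀


-- Dependent choices from a list of lists

-- The tool for reindexing sums and products: with duplicates excluded, two inclusions suffice.
unique⇒↭ : {xs ys : List A} → Unique xs → Unique ys → xs ⊆ˡ ys → ys ⊆ˡ xs → xs ↭ ys
unique⇒↭ xs! ys! xs⊆ys ys⊆xs = ∼bag⇒↭ (unique∧set⇒bag xs! ys! (mk⇔ xs⊆ys ys⊆xs))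

unique⇒allPairs : {R : A → A → Set ℓ} {xs : List A} → Unique xs →
                  (∀ {x y} → x ∈ˡ xs → y ∈ˡ xs → x ≢ y → R x y) → AllPairs R xs
unique⇒allPairs []         r = []
unique⇒allPairs (x∉ ∷ xs!) r =
  All.tabulate (λ y∈ → r (here refl) (there y∈) (All.lookup x∉ y∈)) ∷
  unique⇒allPairs xs! (λ x∈ y∈ → r (there x∈) (there y∈))

module _ {T : A → Set t} where

  lookup-universal : (h : ∀ x → T x) {xs : List A} {x : A} (x∈ : x ∈ˡ xs) →
                     All.lookup (All.universal h xs) x∈ ≡ h x
  lookup-universal h (here refl) = refl
  lookup-universal h (there x∈)  = lookup-universal h x∈

  universal-≡ : (h : ∀ x → T x) {xs : List A} (ts : All T xs) →
                (∀ {x} (x∈ : x ∈ˡ xs) → h x ≡ All.lookup ts x∈) → All.universal h xs ≡ ts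
  universal-≡ h []       eq = refl
  universal-≡ h (t ∷ ts) eq = cong₂ _∷_ (eq (here refl)) (universal-≡ h ts (eq ∘ there))

  reduce-universal : (f : ∀ {x} → T x → B) (h : ∀ x → T x) (xs : List A) →
                     All.reduce f (All.universal h xs) ≡ map (λ x → f (h x)) xs
  reduce-universal f h []       = refl
  reduce-universal f h (x ∷ xs) = cong (f (h x) ∷_) (reduce-universal f h xs)

  module _ (L : ∀ x → List (T x)) where

    -- The index set of an expanded product of sums. A choice is a dependent family because the type
    -- of the summation index varies with the factor.
    choices : (xs : List A) → List (All T xs)
    choices []       = [] ∷ []
    choices (x ∷ xs) = cartesianProductWith _∷_ (L x) (choices xs)

    ∈-choices : (∀ x t → t ∈ˡ L x) → ∀ {xs} (ts : All T xs) → ts ∈ˡ choices xs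
    ∈-choices all []       = here refl
    ∈-choices all (t ∷ ts) = ∈-cartesianProductWith⁺ _∷_ (all _ t) (∈-choices all ts)

    choices-unique : (∀ x → Unique (L x)) → ∀ xs → Unique (choices xs)
    choices-unique L! []       = [] ∷ []
    choices-unique L! (x ∷ xs) =
      Unique.cartesianProductWith⁺ _∷_ (λ { refl → refl , refl }) (L! x) (choices-unique L! xs)

-- Intervals and blocks, block by block

module _ {π σ : NC n} where

  restrictInterval : (W : Subset n) → Interval π σ → Interval (restrict π W) 𝟙
  restrictInterval W y = between (restrict (mid y) W) (restrict-mono W (lower y)) (≼𝟙 _)

  -- The decomposition map from [π , σ] to the product of the intervals [π_W , 1]. Its components
  -- make sense for every subset `W`, so no membership proofs occur in the family.
  restrictions : Interval π σ → All (λ W → Interval (restrict π W) 𝟙) (blocks σ)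
  restrictions y = All.universal (λ W → restrictInterval W y) (blocks σ)

  restrictions-injective : ∀ {x y} → restrictions x ≡ restrictions y → x ≡ y
  restrictions-injective {x} {y} eq = mid-injective
    (restrict-reflects-≡ (upper x) (upper y) λ W∈σ → cong mid
      (trans (sym (lookup-universal _ W∈σ))
        (trans (cong (λ ts → All.lookup ts W∈σ) eq) (lookup-universal _ W∈σ))))

  -- A preimage is obtained by gluing the chosen middle partitions.
  restrictions-surjective : π ≼ σ → ∀ ts → ∃[ y ] restrictions y ≡ ts
  restrictions-surjective π≼σ ts = y , universal-≡ _ ts λ W∈σ →
    mid-injective (trans (restrict-glue W∈σ) (τ-≡ W∈σ))
    where
    τ : ∀ W → NC ∣ W ∣
    τ W with _∈?_ _≟ˢ_ W (blocks σ)
    ... | yes W∈σ = mid (All.lookup ts W∈σ)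
    -- A default value outside the blocks of σ.
    ... | no  _   = 𝟙
    τ-≡ : ∀ {W} (W∈σ : W ∈ˡ blocks σ) → τ W ≡ mid (All.lookup ts W∈σ)
    τ-≡ {W} W∈σ with _∈?_ _≟ˢ_ W (blocks σ)
    -- The decision procedure may return another membership proof, but `blocks σ` has no duplicates,
    -- so the two proofs are equal.
    ... | yes W∈σ′ = cong (mid ∘ All.lookup ts) (unique⇒irrelevant (blocks-unique σ) W∈σ′ W∈σ)
    ... | no  W∉σ  = contradiction W∈σ W∉σ
    open Glue σ τ
    y : Interval π σ
    y = between glue
      (≼-glue π≼σ λ W∈σ → subst (_ ≼_) (sym (τ-≡ W∈σ)) (lower (All.lookup ts W∈σ))) glue-≼

  -- The product decomposition of the interval, as a permutation of index lists fit for reindexing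
  -- the convolution sum.
  interval-↭ : π ≼ σ → map restrictions (interval π σ) ↭
                       choices (λ W → interval (restrict π W) 𝟙) (blocks σ)
  interval-↭ π≼σ = unique⇒↭
    (Unique.map⁺ restrictions-injective interval-unique)
    (choices-unique _ (λ _ → interval-unique) (blocks σ))
    (λ _ → ∈-choices _ (λ _ → ∈-interval) _)
    (λ {ts} _ → let y , eq = restrictions-surjective π≼σ ts in
      subst (_∈ˡ _) eq (∈-map⁺ restrictions (∈-interval y)))

-- Each block of ρ lies in exactly one block `W` of σ and appears there as a block of the
-- restriction of ρ to `W`.
blocks-↭ : {ρ σ : NC n} → ρ ≼ σ →
           blocks ρ ↭ concatMap (λ W → map (embed W) (blocks (restrict ρ W))) (blocks σ)
blocks-↭ {ρ = ρ} {σ} ρ≼σ = unique⇒↭ (blocks-unique ρ)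
  (Unique.concat⁺
    (All.map⁺ (All.universal
      (λ W → Unique.map⁺ (embed-injective W) (blocks-unique (restrict ρ W))) _))
    (AllPairs.map⁺ (unique⇒allPairs (blocks-unique σ) disjoint)))
  ρ⊆ ⊆ρ
  where
  part : Subset _ → List (Subset _)
  part W = map (embed W) (blocks (restrict ρ W))

  part-⊆ρ : ∀ {V W} → W ∈ˡ blocks σ → V ∈ˡ part W → ∃[ k ] V ≡ blockOf ρ (pos W k)
  part-⊆ρ {W = W} W∈σ V∈ with ∈-map⁻ (embed W) V∈
  ... | U , U∈ , refl with ∈blocks⇒blockOf (restrict ρ W) U∈
  ... | k , refl = k , embed-block ρ≼σ W∈σ k

  -- A common member would be a block of ρ through some element of `W` and would also lie in `W′`;
  -- both are then the block of σ containing that element.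
  disjoint : ∀ {W W′} → W ∈ˡ blocks σ → W′ ∈ˡ blocks σ → W ≢ W′ → Disjoint (part W) (part W′)
  disjoint {W} {W′} W∈σ W′∈σ W≢W′ (V∈ , V∈′) with part-⊆ρ W∈σ V∈ | ∈-map⁻ (embed W′) V∈′
  ... | k , refl | U , _ , V≡ = W≢W′ (trans (sym (block-≡ σ W∈σ (pos∈ W k)))
    (block-≡ σ W′∈σ (embed-⊆ W′ U (subst (_ ∈_) V≡ (self (isNCP ρ) (pos W k))))))

  ⊆ρ : concatMap part (blocks σ) ⊆ˡ blocks ρ
  ⊆ρ V∈ with W , W∈σ , V∈part ← find (∈-concatMap⁻ part V∈)
    with k , refl ← part-⊆ρ W∈σ V∈part = blockOf∈blocks ρ (pos W k)

  ρ⊆ : blocks ρ ⊆ˡ concatMap part (blocks σ)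
  ρ⊆ V∈ with i , refl ← ∈blocks⇒blockOf ρ V∈ =
    let W = blockOf σ i
        W∈σ = blockOf∈blocks σ i
        k , i≡ = pos-surjective W (self (isNCP σ) i)
    in ∈-concatMap⁺ part (lose W∈σ (subst (_∈ˡ part W)
         (trans (embed-block ρ≼σ W∈σ k) (cong (blockOf ρ) (sym i≡)))
         (∈-map⁺ (embed W) (blockOf∈blocks (restrict ρ W) k))))

blocks-𝟙 : blocks (𝟙 {suc n}) ≡ ⊤ ∷ []
blocks-𝟙 = ↭-singleton-inv (unique⇒↭ (blocks-unique 𝟙) ([] ∷ []) to from)
  where
  to : blocks 𝟙 ⊆ˡ ⊤ ∷ []
  to W∈ with i , refl ← ∈blocks⇒blockOf 𝟙 W∈ = here (blockOf-𝟙 i)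
  from : ⊤ ∷ [] ⊆ˡ blocks 𝟙
  from (here refl) = subst (_∈ˡ blocks 𝟙) (blockOf-𝟙 zero) (blockOf∈blocks 𝟙 zero)

restrict-block : (σ : NC n) {W : Subset n} → W ∈ˡ blocks σ → restrict σ W ≡ 𝟙
restrict-block σ {W} W∈σ = NC-ext λ i j → trans
  ([]=⇒lookup (∈-restrict⁺ σ W (subst (_ ∈_) (sym (block-≡ σ W∈σ (pos∈ W i))) (pos∈ W j))))
  (sym ([]=⇒lookup (subst (j ∈_) (sym (blockOf-𝟙 i)) ∈⊤)))

-- The sizes ∣ embed W V ∣ and ∣ V ∣ are only propositionally equal, so
-- partitions are compared through their image under an arbitrary F.

module _ (F : ∀ {m} → NC m → A) where

  NC-cong : (eq : m ≡ n) {π : NC m} {ρ : NC n} →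
            (∀ i j → lookup (blockOf π i) j ≡ lookup (blockOf ρ (cast eq i)) (cast eq j)) →
            F π ≡ F ρ
  NC-cong refl {ρ = ρ} eq = cong F (NC-ext λ i j → trans (eq i j)
    (cong₂ (λ x y → lookup (blockOf ρ x) y) (cast-is-id refl i) (cast-is-id refl j)))

  restrict-⊤ : (π : NC n) → F (restrict π ⊤) ≡ F π
  restrict-⊤ {n} π = NC-cong (∣⊤∣≡n n) λ i j → trans (lookup-restrict π ⊤ i j)
    (cong₂ (λ x y → lookup (blockOf π x) y) (pos-⊤ i) (pos-⊤ j))

  restrict-restrict : (π : NC n) (W : Subset n) (V : Subset ∣ W ∣) →
                      F (restrict π (embed W V)) ≡ F (restrict (restrict π W) V)
  restrict-restrict π W V = sym (NC-cong (∣embed∣ W V) λ i j → begin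
    lookup (blockOf (restrict (restrict π W) V) i) j
      ≡⟨ lookup-restrict (restrict π W) V i j ⟩
    lookup (blockOf (restrict π W) (pos V i)) (pos V j)
      ≡⟨ lookup-restrict π W (pos V i) (pos V j) ⟩
    lookup (blockOf π (pos W (pos V i))) (pos W (pos V j))
      ≡⟨ cong₂ (λ x y → lookup (blockOf π x) y) (pos-embed W V i) (pos-embed W V j) ⟨
    lookup (blockOf π (pos (embed W V) (cast (∣embed∣ W V) i)))
           (pos (embed W V) (cast (∣embed∣ W V) j))
      ≡⟨ lookup-restrict π (embed W V) _ _ ⟨
    lookup (blockOf (restrict π (embed W V)) (cast (∣embed∣ W V) i)) (cast (∣embed∣ W V) j) ∎)
    where open ≡-Reasoning

-- Sums and products over lists

module ListFold (M : CommutativeMonoid c ℓ) where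

  open CommutativeMonoid M
    renaming (refl to ≈-refl; sym to ≈-sym; trans to ≈-trans)
  open CommutativeSemigroupProperties commutativeSemigroup using (interchange)

  fold : List A → (A → Carrier) → Carrier
  fold xs F = foldr _∙_ ε (map F xs)

  private variable
    F G : A → Carrier

  fold-cong : (xs : List A) → (∀ {x} → x ∈ˡ xs → F x ≈ G x) → fold xs F ≈ fold xs G
  fold-cong []       F≈G = ≈-refl
  fold-cong (x ∷ xs) F≈G = ∙-cong (F≈G (here refl)) (fold-cong xs (F≈G ∘ there))

  fold-ε : (xs : List A) → (∀ {x} → x ∈ˡ xs → F x ≈ ε) → fold xs F ≈ ε
  fold-ε []       F≈ε = ≈-refl
  fold-ε (x ∷ xs) F≈ε =
    ≈-trans (∙-cong (F≈ε (here refl)) (fold-ε xs (F≈ε ∘ there))) (identityˡ ε)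

  fold-∙ : (xs : List A) → fold xs (λ x → F x ∙ G x) ≈ fold xs F ∙ fold xs G
  fold-∙ []       = ≈-sym (identityˡ ε)
  fold-∙ (x ∷ xs) = ≈-trans (∙-congˡ (fold-∙ xs)) (interchange _ _ _ _)

  fold-map : (h : A → B) (xs : List A) → fold (map h xs) F ≡ fold xs (F ∘ h)
  fold-map h xs = cong (foldr _∙_ ε) (sym (map-∘ xs))

  fold-++ : (xs ys : List A) → fold (xs ++ ys) F ≈ fold xs F ∙ fold ys F
  fold-++ []       ys = ≈-sym (identityˡ _)
  fold-++ (x ∷ xs) ys = ≈-trans (∙-congˡ (fold-++ xs ys)) (≈-sym (assoc _ _ _))

  fold-concatMap : (h : A → List B) (xs : List A) →
                   fold (concatMap h xs) F ≈ fold xs (λ x → fold (h x) F)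
  fold-concatMap h []       = ≈-refl
  fold-concatMap h (x ∷ xs) =
    ≈-trans (fold-++ (h x) (concatMap h xs)) (∙-congˡ (fold-concatMap h xs))

  fold-cartesianProductWith :
    {F : D → Carrier} (h : A → B → D) (xs : List A) (ys : List B) →
    fold (cartesianProductWith h xs ys) F ≈ fold xs (λ x → fold ys (F ∘ h x))
  fold-cartesianProductWith h []       ys = ≈-refl
  fold-cartesianProductWith h (x ∷ xs) ys = ≈-trans
    (fold-++ (map (h x) ys) (cartesianProductWith h xs ys))
    (∙-cong (reflexive (fold-map (h x) ys)) (fold-cartesianProductWith h xs ys))

  fold-↭ : {xs ys : List A} → xs ↭ ys → fold xs F ≈ fold ys F
  fold-↭ {F = F} xs↭ys = Permutation.foldr-commMonoid setoid isCommutativeMonoid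
    (↭⇒↭ₛ′ isEquivalence (map⁺ F xs↭ys))

-- Semi-multiplicative functions and block products

module _ (R : CommutativeRing c ℓ) where

  open CommutativeRing R
    renaming (Carrier to C; refl to ≈-refl; sym to ≈-sym; trans to ≈-trans)
    hiding (zero)
  open SetoidReasoning setoid
  open ListFold +-commutativeMonoid using ()
    renaming (fold to Σ; fold-↭ to Σ-↭; fold-map to Σ-map;
              fold-cartesianProductWith to Σ-cartesianProductWith)
  open ListFold *-commutativeMonoid using ()
    renaming (fold to Π; fold-cong to Π-cong; fold-ε to Π-1#; fold-∙ to Π-*; fold-map to Π-map;
              fold-concatMap to Π-concatMap; fold-↭ to Π-↭)

  private variable
    f g : NC² → C

  infixl 7 _⊛_

  _⊛_ : (NC² → C) → (NC² → C) → (NC² → C)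
  _⊛_ = _⋆_ R

  Π-zero : {F : A → C} {xs : List A} → Any (λ x → F x ≈ 0#) xs → Π xs F ≈ 0#
  Π-zero (here Fx≈0) = ≈-trans (*-congʳ Fx≈0) (zeroˡ _)
  Π-zero (there ∃≈0) = ≈-trans (*-congˡ (Π-zero ∃≈0)) (zeroʳ _)

  -- The generalised distributive law, by induction: expand the product of the remaining sums, then
  -- distribute the first sum over the result.
  Π-Σ : {T : A → Set t} (L : ∀ x → List (T x)) (H : ∀ {x} → T x → C) (xs : List A) →
        Π xs (λ x → Σ (L x) H) ≈ Σ (choices L xs) (λ ts → ∏ R (All.reduce H ts))
  Π-Σ L H []       = ≈-sym (+-identityʳ 1#)
  Π-Σ L H (x ∷ xs) = begin
    Σ (L x) H * Π xs (λ x → Σ (L x) H)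
      ≈⟨ *-congˡ (Π-Σ L H xs) ⟩
    Σ (L x) H * Σ (choices L xs) (λ ts → ∏ R (All.reduce H ts))
      ≈⟨ ∑-*ʳ R (L x) _ ⟩
    Σ (L x) (λ t → H t * Σ (choices L xs) (λ ts → ∏ R (All.reduce H ts)))
      ≈⟨ ∑-cong R (L x) (λ t → ∑-*ˡ R (choices L xs) (H t)) ⟩
    Σ (L x) (λ t → Σ (choices L xs) (λ ts → H t * ∏ R (All.reduce H ts)))
      ≈⟨ Σ-cartesianProductWith _∷_ (L x) (choices L xs) ⟨
    Σ (choices L (x ∷ xs)) (λ ts → ∏ R (All.reduce H ts)) ∎

  -- The values f (π , 1ₘ), with a junk value at m = 0.

  top : (NC² → C) → NC m → C
  top {zero}  f π = 1#
  top {suc m} f π = f (pair π 𝟙 (≼𝟙 π))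

  top-pair : (f : NC² → C) .{{_ : NonZero m}} (π : NC m) → f (pair π 𝟙 (≼𝟙 π)) ≡ top f π
  top-pair {suc m} f π = refl

  -- The right-hand side of semi-multiplicativity without membership proofs: `top` absorbs the
  -- non-emptiness of the blocks, which leaves a plain product that can be permuted and regrouped.
  blockProduct : (NC² → C) → NC n → NC n → C
  blockProduct f π σ = Π (blocks σ) (λ W → top f (restrict π W))

  blockProduct-cong : (∀ {m} (τ : NC m) → top f τ ≈ top g τ) →
                      (π σ : NC n) → blockProduct f π σ ≈ blockProduct g π σ
  blockProduct-cong f≈g π σ = Π-cong (blocks σ) λ {W} _ → f≈g (restrict π W)

  blockProduct-𝟙 : (f : NC² → C) (π : NC n) → blockProduct f π 𝟙 ≈ top f π
  -- The empty product equals the junk value of `top`.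
  blockProduct-𝟙 {zero}  f π = ≈-refl
  blockProduct-𝟙 {suc n} f π = begin
    Π (blocks 𝟙) F         ≡⟨ cong (λ Ws → Π Ws F) (blocks-𝟙 {n}) ⟩
    F ⊤ * 1#               ≈⟨ *-identityʳ _ ⟩
    top f (restrict π ⊤)   ≡⟨ restrict-⊤ (top f) π ⟩
    top f π                ∎
    where
    F : Subset (suc n) → C
    F W = top f (restrict π W)

  -- The blocks of ρ are grouped by the block `W` of σ that contains them; restricting to such a
  -- block is restricting first to `W` and then within it.
  blockProduct-restrict : (f : NC² → C) (π : NC n) {ρ σ : NC n} → ρ ≼ σ →
    blockProduct f π ρ ≈ Π (blocks σ) (λ W → blockProduct f (restrict π W) (restrict ρ W))
  blockProduct-restrict f π {ρ} {σ} ρ≼σ = begin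
    Π (blocks ρ) F
      ≈⟨ Π-↭ (blocks-↭ ρ≼σ) ⟩
    Π (concatMap (λ W → map (embed W) (blocks (restrict ρ W))) (blocks σ)) F
      ≈⟨ Π-concatMap _ (blocks σ) ⟩
    Π (blocks σ) (λ W → Π (map (embed W) (blocks (restrict ρ W))) F)
      ≈⟨ Π-cong (blocks σ) (λ {W} _ → reflexive (Π-map (embed W) (blocks (restrict ρ W)))) ⟩
    Π (blocks σ) (λ W → Π (blocks (restrict ρ W)) (F ∘ embed W))
      ≈⟨ Π-cong (blocks σ) (λ {W} _ → Π-cong (blocks (restrict ρ W)) λ {V} _ →
           reflexive (restrict-restrict (top f) π W V)) ⟩
    Π (blocks σ) (λ W → blockProduct f (restrict π W) (restrict ρ W)) ∎
    where
    F : Subset _ → C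
    F V = top f (restrict π V)

  BlockMultiplicative : (NC² → C) → Set ℓ
  BlockMultiplicative f = ∀ {n} .{{_ : NonZero n}} (π σ : NC n) (π≼σ : π ≼ σ) →
    f (pair π σ π≼σ) ≈ blockProduct f π σ

  module _ (f : NC² → C) where

    private
      mapWith∈-blockPair : (π σ : NC n) → mapWith∈ (blocks σ) (λ W∈σ → f (blockPair π σ W∈σ)) ≡
                                          map (λ W → top f (restrict π W)) (blocks σ)
      mapWith∈-blockPair π σ = trans
        (mapWith∈-cong (blocks σ) _ _ λ {W} W∈σ →
          top-pair f {{block-nonZero σ W∈σ}} (restrict π W))
        (mapWith∈≗map _ (blocks σ))

    semi⇒block : SemiMultiplicative R f → BlockMultiplicative f
    semi⇒block f-semi π σ π≼σ =
      ≈-trans (f-semi π σ π≼σ) (reflexive (cong (∏ R) (mapWith∈-blockPair π σ)))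

    block⇒semi : BlockMultiplicative f → SemiMultiplicative R f
    block⇒semi f-block π σ π≼σ =
      ≈-trans (f-block π σ π≼σ) (reflexive (cong (∏ R) (sym (mapWith∈-blockPair π σ))))

  top-cong : _≐_ R f g → (τ : NC m) → top f τ ≈ top g τ
  top-cong {m = zero}  f≐g τ = ≈-refl
  top-cong {m = suc m} f≐g τ = f≐g _

  block-resp-≐ : _≐_ R f g → BlockMultiplicative f → BlockMultiplicative g
  block-resp-≐ f≐g f-block π σ π≼σ = ≈-trans (≈-sym (f≐g _))
    (≈-trans (f-block π σ π≼σ) (blockProduct-cong (top-cong f≐g) π σ))

  block-determined : BlockMultiplicative f → BlockMultiplicative g →
                     (∀ {m} (τ : NC m) → top f τ ≈ top g τ) → _≐_ R f g
  block-determined f-block g-block f≈g (pair π σ π≼σ) = ≈-trans (f-block π σ π≼σ′)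
    (≈-trans (blockProduct-cong f≈g π σ) (≈-sym (g-block π σ π≼σ′)))
    -- The relation stored in a pair is irrelevant; decidability returns a usable proof.
    where π≼σ′ = recompute (π ≼? σ) π≼σ

  -- Closure under unit, convolution and inverse

  -- If π = σ, every restriction to a block of σ is 1 and all factors are 1. Otherwise some
  -- restriction of π differs from that of σ, which is 1, and its factor vanishes.
  e-block : BlockMultiplicative (e R)
  e-block π σ π≼σ with π ≟ᴺ σ
  ... | yes refl = ≈-trans (e-refl R π≼σ) (≈-sym (Π-1# (blocks σ) λ {W} W∈σ →
    ≈-trans (reflexive (cong (top (e R)) (restrict-block σ W∈σ))) (top-e-𝟙 ∣ W ∣)))
    where
    top-e-𝟙 : ∀ m → top (e R) (𝟙 {m}) ≈ 1#
    top-e-𝟙 zero    = ≈-refl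
    top-e-𝟙 (suc m) = e-refl R {π = 𝟙 {suc m}} (≼-refl 𝟙)
  ... | no π≢σ = ≈-trans (e-≢ R π≼σ π≢σ) (≈-sym (Π-zero (Any.map top-e-≢
    (All.¬All⇒Any¬ (λ W → restrict π W ≟ᴺ 𝟙) (blocks σ) λ πW≡𝟙 → π≢σ
      (restrict-reflects-≡ π≼σ (≼-refl σ) λ W∈σ →
        trans (All.lookup πW≡𝟙 W∈σ) (sym (restrict-block σ W∈σ)))))))
    where
    top-e-≢ : {τ : NC m} → τ ≢ 𝟙 → top (e R) τ ≈ 0#
    -- The junk value is 1 here, but at size 0 there is only one partition, which contradicts the
    -- hypothesis.
    top-e-≢ {zero}  τ≢𝟙 = contradiction (NC-ext λ ()) τ≢𝟙
    top-e-≢ {suc m} τ≢𝟙 = e-≢ R (≼𝟙 _) τ≢𝟙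

  ⋆-block : BlockMultiplicative f → BlockMultiplicative g → BlockMultiplicative (f ⊛ g)
  ⋆-block {f} {g} f-block g-block π σ π≼σ = begin
    (f ⊛ g) (pair π σ π≼σ)
      ≈⟨ ∑-cong R (interval π σ) factor ⟩
    Σ (interval π σ) (λ y → ∏ R (All.reduce H (restrictions y)))
      ≡⟨ Σ-map restrictions (interval π σ) ⟨
    Σ (map restrictions (interval π σ)) (λ ts → ∏ R (All.reduce H ts))
      ≈⟨ Σ-↭ (interval-↭ π≼σ) ⟩
    Σ (choices (λ W → interval (restrict π W) 𝟙) (blocks σ)) (λ ts → ∏ R (All.reduce H ts))
      ≈⟨ Π-Σ _ H (blocks σ) ⟨
    Π (blocks σ) (λ W → Σ (interval (restrict π W) 𝟙) H)
      ≈⟨ Π-cong (blocks σ) (λ {W} W∈σ → Σ-H {{block-nonZero σ W∈σ}} (restrict π W)) ⟩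
    blockProduct (f ⊛ g) π σ ∎
    where
    -- The convolution term at (τ , 1), written so that it makes sense at every size; `Σ-H`
    -- identifies its sum with the value of `f ⊛ g` for non-zero sizes.
    H : {τ : NC m} → Interval τ 𝟙 → C
    H {τ = τ} y = blockProduct f τ (mid y) * top g (mid y)

    factor : ∀ y → convolutionTerm R f g y ≈ ∏ R (All.reduce H (restrictions y))
    factor y = begin
      f (pair π ρ (lower y)) * g (pair ρ σ (upper y))
        ≈⟨ *-cong (f-block π ρ (lower y)) (g-block ρ σ (upper y)) ⟩
      blockProduct f π ρ * blockProduct g ρ σ
        -- The product for `f` runs over the blocks of ρ; regrouping it over the blocks of σ matches
        -- the product for `g`.
        ≈⟨ *-congʳ (blockProduct-restrict f π (upper y)) ⟩
      Π (blocks σ) (λ W → blockProduct f (restrict π W) (restrict ρ W)) * blockProduct g ρ σ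
        ≈⟨ Π-* (blocks σ) ⟨
      Π (blocks σ) (λ W → H (restrictInterval W y))
        ≡⟨ cong (∏ R) (reduce-universal H (λ W → restrictInterval W y) (blocks σ)) ⟨
      ∏ R (All.reduce H (restrictions y)) ∎
      where ρ = mid y

    Σ-H : .{{_ : NonZero m}} (τ : NC m) → Σ (interval τ 𝟙) H ≈ top (f ⊛ g) τ
    Σ-H τ = ≈-trans
      (∑-cong R (interval τ 𝟙) λ y → ≈-sym (*-cong
        (f-block τ (mid y) (lower y)) (reflexive (top-pair g (mid y)))))
      (reflexive (top-pair (f ⊛ g) τ))

  inv-block : Unital R f → BlockMultiplicative f → BlockMultiplicative (inv R f)
  inv-block {f} f-unital f-block = block-resp-≐ h′≐h h′-block
    where
    h = inv R f

    h′ : NC² → C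
    h′ (pair π σ _) = blockProduct h π σ

    top-h′ : (τ : NC m) → top h′ τ ≈ top h τ
    top-h′ {zero}  τ = ≈-refl
    top-h′ {suc m} τ = blockProduct-𝟙 h τ

    h′-block : BlockMultiplicative h′
    -- `h′` is built from the top values of `h`, which are also its own top values.
    h′-block π σ _ = blockProduct-cong (≈-sym ∘ top-h′) π σ

    top-f⋆h′ : (τ : NC m) → top (f ⊛ h′) τ ≈ top (e R) τ
    top-f⋆h′ {zero}  τ = ≈-refl
    top-f⋆h′ {suc m} τ = ≈-trans
      -- The second factor of each term is taken at a pair ending in 1, where `h′` and `h` agree.
      (∑-cong R (interval τ 𝟙) λ y → *-congˡ (top-h′ (mid y)))
      (⋆-inverseʳ R f-unital (pair τ 𝟙 (≼𝟙 τ)))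

    f⋆h′≐e : _≐_ R (f ⊛ h′) (e R)
    f⋆h′≐e = block-determined (⋆-block f-block h′-block) e-block top-f⋆h′

    -- `inv` is constructed as a right inverse; the group structure makes it a left inverse as well,
    -- so `f` can be cancelled from `f ⊛ h′`.
    h⋆f≐e : _≐_ R (h ⊛ f) (e R)
    h⋆f≐e = Group.inverseˡ (𝓕-group R) (record { fun = f ; unital = f-unital })

    h′≐h : _≐_ R h′ h
    h′≐h x = begin
      h′ x               ≈⟨ ⋆-identityˡ R h′ x ⟨
      (e R ⊛ h′) x       ≈⟨ ⋆-cong R {g = h′} h⋆f≐e (λ _ → ≈-refl) x ⟨
      ((h ⊛ f) ⊛ h′) x   ≈⟨ ⋆-assoc R h f h′ x ⟩
      (h ⊛ (f ⊛ h′)) x   ≈⟨ ⋆-cong R {f = h} (λ _ → ≈-refl) f⋆h′≐e x ⟩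
      (h ⊛ e R) x        ≈⟨ ⋆-identityʳ R h x ⟩
      h x                ∎

theorem4p3 : ∀ {c ℓ} (R : CommutativeRing c ℓ) → IsSubgroup (𝓕-group R) (𝓖̃ R)
theorem4p3 R = record
  { resp      = λ {f} {g} f≐g f∈ → 𝓖̃-intro g
      (block-resp-≐ R f≐g (𝓖̃-block f f∈))
  ; ε-closed  = 𝓖̃-intro ε (e-block R)
  ; ∙-closed  = λ {f} {g} f∈ g∈ → 𝓖̃-intro (f ∙ g) (⋆-block R (𝓖̃-block f f∈) (𝓖̃-block g g∈))
  ; ⁻¹-closed = λ {f} f∈ → 𝓖̃-intro (f ⁻¹) (inv-block R (𝓕.unital f) (𝓖̃-block f f∈))
  }
  where
  open Group (𝓕-group R) using (ε; _∙_; _⁻¹)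
  𝓖̃-block : ∀ f → 𝓖̃ R f → BlockMultiplicative R (𝓕.fun f)
  𝓖̃-block f = semi⇒block R (𝓕.fun f) ∘ IsUnitizedSemiMultiplicative.semiMultiplicative
  -- Unitality comes with each element of `𝓕`; the block formula remains to be supplied.
  𝓖̃-intro : ∀ f → BlockMultiplicative R (𝓕.fun f) → 𝓖̃ R f
  𝓖̃-intro f f-block = record
    { unital = 𝓕.unital f ; semiMultiplicative = block⇒semi R (𝓕.fun f) f-block }
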